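{- Let $M$ be a loopless matroid of rank $r$ on $n$ elements. Then $F(M)\in V^n_r$. Moreover the expansion of $F(M)$ in terms of the basis elements $\mathcal{N}^n_r$ has only nonnegative integer coefficients.
   Context: A composition $\alpha=(\alpha_1,\dots,\alpha_m)$ is a finite (possibly empty) sequence of positive integers; $\ell(\alpha)=m$ is its length and $|\alpha|=\alpha_1+\cdots+\alpha_m$ its weight. The empty composition is denoted $\mathbf{0}$. The rank of $\alpha$ is $r(\alpha)=\alpha_1+\alpha_3+\alpha_5+\cdots$ (sum of odd-indexed parts). For compositions of the same weight $n$, $\beta$ refines $\alpha$ ($\beta\preccurlyeq\alpha$) if the set of proper partial sums of $\alpha$ (a subset of $\{1,\dots,n-1\}$) is contained in that of $\beta$. $\mathrm{QSym}$ is the ring of quasisymmetric functions in the ordered variables $x_1,x_2,\dots$, with monomial basis $\mathbf{x}^\alpha=\sum_{1\le i_1<\cdots<i_m}x_{i_1}^{\alpha_1}\cdots x_{i_m}^{\alpha_m}$ and fundamental basis $L_\alpha=\sum_{\beta\preccurlyeq\alpha}\mathbf{x}^\beta$ (with $L_{\mathbf 0}=1$). A permutation of a finite set $X$ of positive integers is a sequence $\pi$ listing each element of $X$ exactly once; $C(\pi)$ is the composition whose parts are the lengths of the successive maximal increasing runs of $\pi$. A labeled poset $P$ is a partial order $\le_P$ on a finite set of positive integers (the labels). $\mathcal{L}(P)$ is the set of linear extensions of $P$, i.e. permutations of the label set in which $x$ appears before $y$ whenever $x<_P y$. The quasisymmetric function of $P$ is $F(P)=\sum_{\pi\in\mathcal{L}(P)}L_{C(\pi)}$.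 A labeled poset is strictly labeled if $x<_P y$ implies $x>y$ as integers. $P\oplus Q$ denotes the ordinal sum of posets (all elements of $P$ lie below all elements of $Q$). For a nonempty composition $\alpha$ with $\ell(\alpha)=m$, let $P_\alpha=A_1\oplus\cdots\oplus A_m$, where $A_i$ is an antichain with $\alpha_i$ elements, labeled by $1,\dots,|\alpha|$ as follows: first the elements of $A_2,A_4,\dots$ are numbered consecutively, followed by the elements of $A_1,A_3,\dots$. Define $N_\alpha=F(P_\alpha)$, and $N_{\mathbf 0}=1$. The set $\{N_\alpha\}$ is a $\mathbb{Z}$-basis of $\mathrm{QSym}$. Set $\mathcal{N}^0_0=\{N_{\mathbf 0}\}=\{1\}$ and, for $1\le r\le n$, $\mathcal{N}^n_r=\{N_\alpha : |\alpha|=n,\ r(\alpha)=r\}$; $V^n_r$ is the span of $\mathcal{N}^n_r$ (the coefficient ring may be taken to be $\mathbb{Q}$ or $\mathbb{Z}$). For a matroid $M$ with ground set $E(M)$ and set of bases $\mathcal{B}(M)$, and $B\in\mathcal{B}(M)$, let $P_B$ be the poset on $E(M)$ in which $e<_{P_B}e'$ iff $e\in B$, $e'\in E(M)\setminus B$ and $(B\setminus\{e\})\cup\{e'\}\in\mathcal{B}(M)$; give $P_B$ any strict labeling ($F(P_B)$ does not depend on the choice). The quasisymmetric function of $M$ is $F(M)=\sum_{B\in\mathcal{B}(M)}F(P_B)$. -}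

module Defs where

open import Data.Bool.Base using (if_then_else_)
open import Data.Fin.Base using (Fin; toℕ; splitAt; join)
open import Data.Fin.Properties using (all?; toℕ<n; toℕ-injective; join-splitAt)
  renaming (_≟_ to _≟F_)
open import Data.Fin.Subset
  using (Subset; inside; outside; _∈_; _∉_; _-_; _∪_; ⁅_⁆; ∣_∣)
open import Data.Fin.Subset.Properties using (_∈?_)
open import Data.Integer.Base as ℤ using (ℤ; 0ℤ; 1ℤ)
open import Data.List.Base
  using (List; []; _∷_; _++_; map; concatMap; filter; foldr; allFin)
import Data.List.Membership.Propositional as List∈
open import Data.List.Membership.Propositional.Properties
  using (∈-++⁺ˡ; ∈-++⁺ʳ; ∈-map⁺)
open import Data.List.Properties using (≡-dec)
import Data.List.Relation.Binary.Sublist.DecPropositional as Sublist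
import Data.List.Relation.Binary.Subset.DecPropositional as ListSubset
open import Data.List.Relation.Unary.All as All using (All; []; _∷_)
open import Data.List.Relation.Unary.All.Properties using (++⁺; map⁺)
open import Data.List.Relation.Unary.Any using (here)
open import Data.Nat.Base
  using (ℕ; zero; suc; _+_; _<_; _≤_; NonZero; nonZero; >-nonZero; s≤s; z≤n)
open import Data.Nat.ListAction using (sum)
open import Data.Nat.Properties as ℕ
  using (nonZero?; +-cancelˡ-≡; m≤m+n; +-monoʳ-<; ≤-trans; <-≤-trans; ≤-refl;
         +-assoc; suc-injective; n≮n)
open import Data.Product.Base using (∃; _×_; _,_)
open import Data.Sum.Base using (_⊎_; inj₁; inj₂)
open import Data.Sum.Relation.Binary.LeftOrder
  using (_⊎-<_; ⊎-<-decidable; ⊎-<-transitive; ⊎-<-irreflexive)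
open import Data.Sum.Relation.Binary.Pointwise using (≡⇒Pointwise-≡)
open import Data.Empty using (⊥; ⊥-elim)
open import Data.Vec.Base using ([]; _∷_)
open import Relation.Binary.Core using (Rel)
open import Relation.Binary.Definitions using (Decidable)
open import Relation.Binary.Structures using (IsDecStrictPartialOrder)
open import Relation.Binary.PropositionalEquality
  using (_≡_; refl; sym; trans; cong; subst; isEquivalence)
open import Relation.Nullary using (¬_; does; no)
open import Relation.Nullary.Decidable using (_×-dec_; _→-dec_; ¬?)
import Relation.Unary as U
open import Level using (0ℓ)

private
  variable
    m n : ℕ

IsComposition : List ℕ → Set
IsComposition = All NonZero

mutual
  -- Parts are indexed from 1, so the head is an odd-indexed part.
  rank : List ℕ → ℕ
  rank []      = 0
  rank (a ∷ α) = a + evenSum α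

  evenSum : List ℕ → ℕ
  evenSum []      = 0
  evenSum (a ∷ α) = rank α

incrHead : List ℕ → List ℕ
incrHead []      = []
incrHead (a ∷ α) = suc a ∷ α

-- Every composition of weight n occurs exactly once.
compositions : ℕ → List (List ℕ)
compositions 0             = [] ∷ []
compositions 1             = (1 ∷ []) ∷ []
compositions (suc (suc n)) =
  map (1 ∷_) (compositions (suc n)) ++ map incrHead (compositions (suc n))

compositions-sound : ∀ n →
  All (λ α → IsComposition α × sum α ≡ n) (compositions n)
compositions-sound 0             = ([] , refl) ∷ []
compositions-sound 1             = (nonZero ∷ [] , refl) ∷ []
compositions-sound (suc (suc n)) = ++⁺
  (map⁺ (All.map (λ (p , e) → nonZero ∷ p , cong suc e) (compositions-sound (suc n))))
  (map⁺ (All.map (λ {α} → incr α) (compositions-sound (suc n))))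
  where
  incr : ∀ α → IsComposition α × sum α ≡ suc n →
         IsComposition (incrHead α) × sum (incrHead α) ≡ suc (suc n)
  incr (a ∷ α) (_ ∷ p , e) = nonZero ∷ p , cong suc e

compositions-complete : ∀ {α} n → IsComposition α → sum α ≡ n →
                        α List∈.∈ compositions n
compositions-complete {[]}               0 p refl = here refl
compositions-complete {zero ∷ α}         n (() ∷ _) e
compositions-complete {suc 0 ∷ []}       1 p refl = here refl
compositions-complete {suc 0 ∷ zero ∷ α} 1 (_ ∷ () ∷ _) e
compositions-complete {suc 0 ∷ α}        (suc (suc n)) (_ ∷ p) e =
  ∈-++⁺ˡ (∈-map⁺ (1 ∷_) (compositions-complete (suc n) p (suc-injective e)))
compositions-complete {suc (suc a) ∷ α}  (suc (suc n)) (_ ∷ p) e =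
  ∈-++⁺ʳ (map (1 ∷_) (compositions (suc n))) (∈-map⁺ incrHead
    (compositions-complete {suc a ∷ α} (suc n) (nonZero ∷ p) (suc-injective e)))

properPartialSums : List ℕ → List ℕ
properPartialSums []          = []
properPartialSums (a ∷ [])    = []
properPartialSums (a ∷ b ∷ α) = a ∷ map (a +_) (properPartialSums (b ∷ α))

open ListSubset ℕ._≟_ using () renaming (_⊆_ to _⊆ₛ_; _⊆?_ to _⊆ₛ?_)

-- β ≼ α : β refines α.
_≼_ : List ℕ → List ℕ → Set
β ≼ α = sum β ≡ sum α × properPartialSums α ⊆ₛ properPartialSums β

_≼?_ : Decidable _≼_
β ≼? α = (sum β ℕ.≟ sum α) ×-dec (properPartialSums α ⊆ₛ? properPartialSums β)

-- The list e₁ ∷ … ∷ eₖ ∷ [] stands for the monomial x₁^e₁ ⋯ xₖ^eₖ.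
-- Trailing zeros do not change the monomial, and no series built below
-- distinguishes lists that differ only by them.
Monomial : Set
Monomial = List ℕ

-- Formal power series in x₁, x₂, … over ℤ, given by their coefficients.
Series : Set
Series = Monomial → ℤ

infix 4 _≈_
_≈_ : Rel Series 0ℓ
f ≈ g = ∀ e → f e ≡ g e

infixr 7 _•_
_•_ : ℤ → Series → Series
(c • f) e = c ℤ.* f e

∑ : {A : Set} → List A → (A → Series) → Series
∑ xs f e = foldr ℤ._+_ 0ℤ (map (λ x → f x e) xs)

-- x^e occurs in the sum of x_{i₁}^α₁ ⋯ x_{iₘ}^αₘ over i₁ < ⋯ < iₘ once if
-- the nonzero exponents in e, read in order, are α₁ , … , αₘ, and
-- otherwise not at all.
𝐱^ : List ℕ → Series
𝐱^ α e = if does (≡-dec ℕ._≟_ (filter nonZero? e) α) then 1ℤ else 0ℤ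

L : List ℕ → Series
L α = ∑ (filter (_≼? α) (compositions (sum α))) 𝐱^

-- The lengths of the maximal increasing runs.
C : List ℕ → List ℕ
C []          = []
C (x ∷ [])    = 1 ∷ []
C (x ∷ y ∷ π) = if does (x ℕ.<? y) then incrHead (C (y ∷ π)) else 1 ∷ C (y ∷ π)

-- A labeled poset with n elements is a partial order on Fin n together with
-- distinct positive labels; transporting the order along the labels gives a
-- partial order on a set of positive integers.
record FinPoset (n : ℕ) : Set₁ where
  infix 4 _≺_
  field
    _≺_                     : Rel (Fin n) 0ℓ
    isDecStrictPartialOrder : IsDecStrictPartialOrder _≡_ _≺_
  open IsDecStrictPartialOrder isDecStrictPartialOrder public
    using (irrefl) renaming (_<?_ to _≺?_; trans to ≺-trans)

record Labeling (n : ℕ) : Set where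
  field
    label     : Fin n → ℕ
    positive  : ∀ x → NonZero (label x)
    injective : ∀ {x y} → label x ≡ label y → x ≡ y

IsStrict : FinPoset n → Labeling n → Set
IsStrict P ω = ∀ {x y} → x ≺ y → label y < label x
  where
  open FinPoset P
  open Labeling ω

insertions : {A : Set} → A → List A → List (List A)
insertions x []       = (x ∷ []) ∷ []
insertions x (y ∷ ys) = (x ∷ y ∷ ys) ∷ map (y ∷_) (insertions x ys)

permutations : {A : Set} → List A → List (List A)
permutations []       = [] ∷ []
permutations (x ∷ xs) = concatMap (insertions x) (permutations xs)

module _ {n : ℕ} where
  open Sublist (_≟F_ {n}) public
    using () renaming (_⊆_ to _isSublistOf_; _⊆?_ to _isSublistOf?_)

module _ (P : FinPoset n) where
  open FinPoset P

  -- Only meaningful for a permutation π of the elements of P.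
  IsLinearExtension : List (Fin n) → Set
  IsLinearExtension π = ∀ x y → x ≺ y → (x ∷ y ∷ []) isSublistOf π

  isLinearExtension? : U.Decidable IsLinearExtension
  isLinearExtension? π =
    all? λ x → all? λ y → (x ≺? y) →-dec ((x ∷ y ∷ []) isSublistOf? π)

  linearExtensions : List (List (Fin n))
  linearExtensions = filter isLinearExtension? (permutations (allFin n))

F : FinPoset n → Labeling n → Series
F P ω = ∑ (linearExtensions P) λ π → L (C (map (Labeling.label ω) π))

antichain : ∀ a → FinPoset a
antichain a = record
  { _≺_ = λ _ _ → ⊥
  ; isDecStrictPartialOrder = record
    { isStrictPartialOrder = record
      { isEquivalence = isEquivalence
      ; irrefl        = λ _ ()
      ; trans         = λ ()
      ; <-resp-≈      = (λ _ ()) , (λ _ ())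
      }
    ; _≟_  = _≟F_
    ; _<?_ = λ _ _ → no λ ()
    }
  }

infixr 6 _⊕_
_⊕_ : FinPoset m → FinPoset n → FinPoset (m + n)
_⊕_ {m} {n} P Q = record
  { _≺_ = λ x y → (P._≺_ ⊎-< Q._≺_) (splitAt m x) (splitAt m y)
  ; isDecStrictPartialOrder = record
    { isStrictPartialOrder = record
      { isEquivalence = isEquivalence
      ; irrefl        = λ { refl →
          ⊎-<-irreflexive P.irrefl Q.irrefl (≡⇒Pointwise-≡ refl) }
      ; trans         = ⊎-<-transitive P.≺-trans Q.≺-trans
      ; <-resp-≈      = (λ { refl p → p }) , (λ { refl p → p })
      }
    ; _≟_  = _≟F_
    ; _<?_ = λ x y →
        ⊎-<-decidable P._≺?_ Q._≺?_ (splitAt m x) (splitAt m y)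
    }
  }
  where
  module P = FinPoset P
  module Q = FinPoset Q

chainOfAntichains : ∀ α → FinPoset (sum α)
chainOfAntichains []      = antichain 0
chainOfAntichains (a ∷ α) = antichain a ⊕ chainOfAntichains α

-- A₁, A₃, … are numbered consecutively from s on, and A₂, A₄, … from t on.
numbering : (s t : ℕ) → ∀ α → Fin (sum α) → ℕ
numbering s t (a ∷ α) x with splitAt a x
... | inj₁ i = s + toℕ i
... | inj₂ y = numbering t (s + a) α y

private
  Within : ℕ → ℕ → ℕ → Set
  Within s k v = s ≤ v × v < s + k

  Separated : ℕ → ℕ → List ℕ → Set
  Separated s t α = t + evenSum α ≤ s ⊎ s + rank α ≤ t

  separated-tail : ∀ {s t} a α → Separated s t (a ∷ α) → Separated t (s + a) α
  separated-tail {s} a α (inj₁ p) = inj₂ (≤-trans p (m≤m+n s a))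
  separated-tail {s} {t} a α (inj₂ p) =
    inj₁ (subst (_≤ t) (sym (+-assoc s a (evenSum α))) p)

  head-within : ∀ s a α (i : Fin a) → Within s (rank (a ∷ α)) (s + toℕ i)
  head-within s a α i =
    m≤m+n s (toℕ i) , +-monoʳ-< s (<-≤-trans (toℕ<n i) (m≤m+n a _))

  numbering-within : ∀ s t α x →
    Within s (rank α) (numbering s t α x) ⊎ Within t (evenSum α) (numbering s t α x)
  numbering-within s t (a ∷ α) x with splitAt a x
  ... | inj₁ i = inj₁ (head-within s a α i)
  ... | inj₂ y with numbering-within t (s + a) α y
  ...   | inj₁ p       = inj₂ p
  ...   | inj₂ (p , q) = inj₁ (≤-trans (m≤m+n s a) p ,
                               subst (numbering t (s + a) α y <_) (+-assoc s a (evenSum α)) q)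

  within-disjoint : ∀ {s k t l v} → t + l ≤ s ⊎ s + k ≤ t →
                    Within s k v → Within t l v → ⊥
  within-disjoint (inj₁ h) (p , _) (_ , q) = n≮n _ (<-≤-trans q (≤-trans h p))
  within-disjoint (inj₂ h) (_ , p) (q , _) = n≮n _ (<-≤-trans p (≤-trans h q))

  head≢tail : ∀ {s t} a α → Separated s t (a ∷ α) → ∀ (i : Fin a) y →
              ¬ (s + toℕ i ≡ numbering t (s + a) α y)
  head≢tail {s} {t} a α h i y e with numbering-within t (s + a) α y
  ... | inj₁ q       = within-disjoint h (head-within s a α i)
                         (subst (Within t (rank α)) (sym e) q)
  ... | inj₂ (q , _) =
    n≮n _ (<-≤-trans (+-monoʳ-< s (toℕ<n i)) (subst (s + a ≤_) (sym e) q))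

  numbering-injective : ∀ s t α → Separated s t α → ∀ x y →
    numbering s t α x ≡ numbering s t α y → x ≡ y
  numbering-injective s t (a ∷ α) h x y e =
    trans (sym (join-splitAt a _ x))
      (trans (cong (join a _) split≡) (join-splitAt a _ y))
    where
    split≡ : splitAt a x ≡ splitAt a y
    split≡ with splitAt a x | splitAt a y
    ... | inj₁ i | inj₁ j = cong inj₁ (toℕ-injective (+-cancelˡ-≡ s _ _ e))
    ... | inj₁ i | inj₂ z = ⊥-elim (head≢tail a α h i z e)
    ... | inj₂ w | inj₁ j = ⊥-elim (head≢tail a α h j w (sym e))
    ... | inj₂ w | inj₂ z = cong inj₂
      (numbering-injective t (s + a) α (separated-tail a α h) w z e)

  numbering-positive : ∀ s t α → 1 ≤ s → 1 ≤ t → ∀ x → 1 ≤ numbering s t α x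
  numbering-positive s t α 1≤s 1≤t x with numbering-within s t α x
  ... | inj₁ (p , _) = ≤-trans 1≤s p
  ... | inj₂ (p , _) = ≤-trans 1≤t p

labeling : ∀ α → Labeling (sum α)
labeling α = record
  { label     = numbering (suc (evenSum α)) 1 α
  ; positive  = λ x → >-nonZero
      (numbering-positive (suc (evenSum α)) 1 α (s≤s z≤n) ≤-refl x)
  ; injective = λ {x} {y} →
      numbering-injective (suc (evenSum α)) 1 α (inj₁ ≤-refl) x y
  }

N : List ℕ → Series
N α = F (chainOfAntichains α) (labeling α)

-- The indices of the elements of 𝒩ⁿᵣ.
𝒩 : (n r : ℕ) → List (List ℕ)
𝒩 n r = filter (λ α → rank α ℕ.≟ r) (compositions n)

-- ∑ c_α N_α over the elements N_α of 𝒩ⁿᵣ.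
combination : (n r : ℕ) → (List ℕ → ℤ) → Series
combination n r c = ∑ (𝒩 n r) λ α → c α • N α

-- Membership of f in Vⁿᵣ, with ℤ as the coefficient ring.
V : (n r : ℕ) → Series → Set
V n r f = ∃ λ c → f ≈ combination n r c

exchange : Fin n → Fin n → Subset n → Subset n
exchange e e′ B = (B - e) ∪ ⁅ e′ ⁆

record Matroid (n : ℕ) : Set₁ where
  field
    IsBasis       : Subset n → Set
    isBasis?      : U.Decidable IsBasis
    nonempty      : ∃ IsBasis
    basisExchange : ∀ {B B′ e} → IsBasis B → IsBasis B′ → e ∈ B → e ∉ B′ →
                    ∃ λ e′ → e′ ∈ B′ × e′ ∉ B × IsBasis (exchange e e′ B)

subsets : ∀ n → List (Subset n)
subsets zero    = [] ∷ []
subsets (suc n) = map (inside ∷_) (subsets n) ++ map (outside ∷_) (subsets n)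

module _ (M : Matroid n) where
  open Matroid M

  IsLoop : Fin n → Set
  IsLoop e = ∀ {B} → IsBasis B → e ∉ B

  Loopless : Set
  Loopless = ∀ e → ¬ IsLoop e

  HasRank : ℕ → Set
  HasRank r = ∃ λ B → IsBasis B × ∣ B ∣ ≡ r

  -- Defined for every subset B, but only used when B is a basis.
  basisPoset : Subset n → FinPoset n
  basisPoset B = record
    { _≺_ = λ e e′ → e ∈ B × e′ ∉ B × IsBasis (exchange e e′ B)
    ; isDecStrictPartialOrder = record
      { isStrictPartialOrder = record
        { isEquivalence = isEquivalence
        ; irrefl        = λ { refl (p , q , _) → q p }
        ; trans         = λ (_ , q , _) (p , _) → ⊥-elim (q p)
        ; <-resp-≈      = (λ { refl p → p }) , (λ { refl p → p })
        }
      ; _≟_  = _≟F_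
      ; _<?_ = λ e e′ →
          (e ∈? B) ×-dec ¬? (e′ ∈? B) ×-dec isBasis? (exchange e e′ B)
      }
    }

  bases : List (Subset n)
  bases = filter isBasis? (subsets n)

  -- A choice of a labeling for each P_B; its values off the bases are not used.
  LabelingChoice : Set
  LabelingChoice = Subset n → Labeling n

  IsStrictChoice : LabelingChoice → Set
  IsStrictChoice ω = ∀ {B} → IsBasis B → IsStrict (basisPoset B) (ω B)

  Fᴹ : LabelingChoice → Series
  Fᴹ ω = ∑ bases λ B → F (basisPoset B) (ω B)

{-# OPTIONS --safe #-}

-- A linear extension of P_B is a word in the letters of B and of its
-- complement; cutting it where it switches between the two gives an ordered set
-- partition A₁ , A₂ , … of the ground set.  Since M is loopless, every element
-- outside B lies above one of B, so A₁ ⊆ B.  As P_B has height two, the words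
-- with a given ordered partition are either all or none of them linear
-- extensions, and in the first case they are those of A₁ ⊕ A₂ ⊕ ⋯ .  Label B
-- above its complement: this keeps the labeling strict, and each sum of
-- antichains then contributes N_α with αᵢ = |Aᵢ|, of rank |B| = r.  Hence F(M)
-- is a sum of such N_α.  Changing the labels is justified by (P, ω)-partitions:
-- the coefficients of F(P, ω) count functions on P whose defining conditions
-- only involve the ascents and descents of ω along the order of P.
module Submission where

open import Algebra.Properties.CommutativeSemigroup using (interchange)
open import Data.Bool.Base using (Bool; true; false; not; if_then_else_)
import Data.Bool.Properties as Bool
open import Data.Empty using (⊥-elim)
open import Data.Fin.Base as Fin using (Fin; toℕ; splitAt)
open import Data.Fin.Properties using (toℕ<n; toℕ-injective; any?)
  renaming (_≟_ to _≟F_)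
open import Data.Fin.Subset
  using (Subset; inside; outside; _-_; _─_; _∪_; ⁅_⁆; ∣_∣; _⊆_)
  renaming (_∈_ to _∈ₛ_; _∉_ to _∉ₛ_)
import Data.Fin.Subset.Properties as Subset
open import Data.Integer using (+_)
open import Data.Integer.Base as ℤ using (ℤ; 0ℤ; 1ℤ)
import Data.Integer.Properties as ℤ
open import Data.List using (List)
open import Data.List.Base
  using ([]; _∷_; _++_; map; filter; length; foldr; allFin; replicate; tabulate; deduplicate)
open import Data.List.Membership.Propositional using (_∈_; _∉_)
open import Data.List.Membership.Propositional.Properties
open import Data.List.Membership.Propositional.Properties.WithK using (unique∧set⇒bag)
import Data.List.Properties as List
open import Data.List.Relation.Binary.BagAndSetEquality using (∼bag⇒↭)
open import Data.List.Relation.Binary.Permutation.Propositional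
  using (_↭_; ↭-refl; ↭-sym; ↭-trans; ↭-prep; ↭-swap; ↭-reflexive; ↭⇒↭ₛ)
open import Data.List.Relation.Binary.Permutation.Propositional.Properties
  using (↭-empty-inv; ¬x∷xs↭[]; ∈-resp-↭; All-resp-↭; ↭-length; shift; drop-∷; map⁺; filter-↭)
open import Data.List.Relation.Binary.Permutation.Setoid.Properties using (Unique-resp-↭)
open import Data.List.Relation.Binary.Sublist.Propositional
  using (_∷ʳ_; _∷_; from∈; to∈) renaming (_⊆_ to _⊑_)
open import Data.List.Relation.Unary.All as All using (All; []; _∷_)
import Data.List.Relation.Unary.All.Properties as All
open import Data.List.Relation.Unary.AllPairs as AllPairs using (AllPairs; []; _∷_)
import Data.List.Relation.Unary.AllPairs.Properties as AllPairs
open import Data.List.Relation.Unary.Any using (here; there)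
open import Data.List.Relation.Unary.Linked using (Linked; []; [-]; _∷_)
import Data.List.Relation.Unary.Linked.Properties as Linked
open import Data.List.Relation.Unary.Unique.DecPropositional.Properties using (deduplicate-!)
open import Data.List.Relation.Unary.Unique.Propositional using (Unique)
import Data.List.Relation.Unary.Unique.Propositional.Properties as Unique
open import Data.Nat using (ℕ)
open import Data.Nat.Base as ℕ
  using (zero; suc; _+_; _≤_; _<_; z≤n; s≤s; NonZero; nonZero)
open import Data.Nat.ListAction using (sum)
import Data.Nat.Properties as ℕ
open import Data.Product using (∃; _×_)
open import Data.Product.Base using (_,_; proj₁; proj₂)
open import Data.Sum.Base using (_⊎_; inj₁; inj₂)
open import Data.Sum.Relation.Binary.LeftOrder using (₁∼₂; ₂∼₂)
open import Data.Vec.Base as Vec using ([]; _∷_; lookup)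
open import Data.Vec.Properties using ([]=⇒lookup; lookup⇒[]=)
open import Defs
open import Function.Base using (_∘_; id)
open import Function.Bundles using (_⇔_; mk⇔; Equivalence)
open import Level using (0ℓ)
open import Relation.Binary.Construct.Closure.Transitive using (TransClosure; [_]; _∷_)
open import Relation.Binary.Core using (Rel)
open import Relation.Binary.Definitions
  using (DecidableEquality; Transitive; tri<; tri≈; tri>)
open import Relation.Binary.PropositionalEquality hiding ([_])
open import Relation.Nullary using (¬_; Dec; does; yes; no)
open import Relation.Nullary.Decidable
  using (dec-true; dec-false; ¬?; _×-dec_; decidable-stable)
open import Relation.Unary using (Pred; Decidable)

private
  variable
    A B K : Set
    m n : ℕ

-- Lists

∈-++∷⁻ : ∀ {y v : A} us {vs} → y ∈ us ++ v ∷ vs → y ≢ v → y ∈ us ++ vs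
∈-++∷⁻ us p y≢v with ∈-++⁻ us p
... | inj₁ q         = ∈-++⁺ˡ q
... | inj₂ (here e)  = ⊥-elim (y≢v e)
... | inj₂ (there q) = ∈-++⁺ʳ us q

-- Pigeonhole: the partner of the head is removed from `ys`, and injectivity keeps it from being the
-- partner of a later element. A relation is used instead of a function because partners will be
-- built from proofs of membership.
relation-length-≤ : (R : A → B → Set) (xs : List A) (ys : List B) → Unique xs →
  (∀ {x} → x ∈ xs → ∃ λ y → y ∈ ys × R x y) →
  (∀ {x x′ y} → x ∈ xs → x′ ∈ xs → R x y → R x′ y → x ≡ x′) →
  length xs ≤ length ys
relation-length-≤ R []       ys u       tot inj = z≤n
relation-length-≤ R (x ∷ xs) ys (x≢ ∷ u) tot inj
  with y , y∈ , r ← tot (here refl)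
  with us , vs , refl ← ∈-∃++ y∈ =
  subst (suc (length xs) ≤_) (sym (↭-length (shift y us vs)))
    (s≤s (relation-length-≤ R xs (us ++ vs) u tot′ λ p q → inj (there p) (there q)))
  where
  tot′ : ∀ {x′} → x′ ∈ xs → ∃ λ y′ → y′ ∈ us ++ vs × R x′ y′
  tot′ p with y′ , y′∈ , r′ ← tot (there p) =
    y′ , ∈-++∷⁻ us y′∈ (λ { refl → All.lookup x≢ p (inj (here refl) (there p) r r′) }) , r′

-- Each head occurs in the other list, so the heads are equal or related both ways, and antisymmetry
-- identifies them.
sorted-unique : {R : Rel A 0ℓ} → (∀ {x y} → R x y → R y x → x ≡ y) →
  ∀ {xs ys} → AllPairs R xs → AllPairs R ys → xs ↭ ys → xs ≡ ys
sorted-unique anti {[]}     {ys}     s t p = sym (↭-empty-inv (↭-sym p))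
sorted-unique anti {x ∷ xs} {[]}     s t p = ⊥-elim (¬x∷xs↭[] p)
sorted-unique {R = R} anti {x ∷ xs} {y ∷ ys} (h ∷ s) (k ∷ t) p with heads
  where
  heads : x ≡ y
  heads with ∈-resp-↭ p (here refl) | ∈-resp-↭ (↭-sym p) (here refl)
  ... | here e  | _       = e
  ... | there _ | here e  = sym e
  ... | there a | there b = anti (All.lookup h b) (All.lookup k a)
... | refl = cong (x ∷_) (sorted-unique anti s t (drop-∷ p))

-- Insertion sort. Comparability is asked of entries at different positions, the form in which `Lex`
-- provides it for distinct labels.
sort : {R : Rel A 0ℓ} → Transitive R → ∀ {xs} →
  AllPairs (λ x y → R x y ⊎ R y x) xs → ∃ λ ys → ys ↭ xs × AllPairs R ys
sort             tr {[]}     []      = [] , ↭-refl , []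
sort {R = R} tr {x ∷ xs} (c ∷ cs) with ys , p , s ← sort tr cs =
  let zs , q , t = insert s (All-resp-↭ (↭-sym p) c)
  in  zs , ↭-trans q (↭-prep x p) , t
  where
  insert : ∀ {ys} → AllPairs R ys → All (λ y → R x y ⊎ R y x) ys →
           ∃ λ zs → zs ↭ x ∷ ys × AllPairs R zs
  insert []      []                     = x ∷ [] , ↭-refl , [] ∷ []
  insert (h ∷ s) (inj₁ r ∷ c)           = _ , ↭-refl , (r ∷ All.map (tr r) h) ∷ h ∷ s
  insert {y ∷ ys} (h ∷ s) (inj₂ r ∷ c) with zs , q , t ← insert s c =
    y ∷ zs , ↭-trans (↭-prep y q) (↭-swap y x ↭-refl)
           , All-resp-↭ (↭-sym q) (r ∷ h) ∷ t

unique-map-injective : {f : A → B} {xs : List A} → Unique (map f xs) →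
  ∀ {x y} → x ∈ xs → y ∈ xs → f x ≡ f y → x ≡ y
unique-map-injective (h ∷ u) (here refl) (here refl) e = refl
unique-map-injective (h ∷ u) (here refl) (there q)   e = ⊥-elim (All.lookup h (∈-map⁺ _ q) e)
unique-map-injective (h ∷ u) (there p)   (here refl) e = ⊥-elim (All.lookup h (∈-map⁺ _ p) (sym e))
unique-map-injective (h ∷ u) (there p)   (there q)   e = unique-map-injective u p q e

map-≡-∈ : ∀ {f g : A → B} {xs x} → map f xs ≡ map g xs → x ∈ xs → f x ≡ g x
map-≡-∈ e (here refl) = List.∷-injectiveˡ e
map-≡-∈ e (there p)   = map-≡-∈ (List.∷-injectiveʳ e) p

pairing : {f : A → ℕ} {g : B → ℕ} → ∀ xs ys → map f xs ≡ map g ys →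
  ∃ λ zs → map proj₁ zs ≡ xs × map proj₂ zs ≡ ys × All (λ z → f (proj₁ z) ≡ g (proj₂ z)) zs
pairing []       []       e = [] , refl , refl , []
pairing (x ∷ xs) (y ∷ ys) e with zs , p , q , r ← pairing xs ys (List.∷-injectiveʳ e) =
  (x , y) ∷ zs , cong (x ∷_) p , cong (y ∷_) q , List.∷-injectiveˡ e ∷ r

-- Finite sums

S : List A → (A → ℤ) → ℤ
S xs f = foldr ℤ._+_ 0ℤ (map f xs)

S-cong : ∀ (xs : List A) {f g : A → ℤ} → (∀ {x} → x ∈ xs → f x ≡ g x) → S xs f ≡ S xs g
S-cong []       h = refl
S-cong (x ∷ xs) h = cong₂ ℤ._+_ (h (here refl)) (S-cong xs (h ∘ there))

S-zero : ∀ (xs : List A) → S xs (λ _ → 0ℤ) ≡ 0ℤ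
S-zero []       = refl
S-zero (x ∷ xs) = trans (ℤ.+-identityˡ _) (S-zero xs)

S-+ : ∀ (xs : List A) (f g : A → ℤ) → S xs (λ x → f x ℤ.+ g x) ≡ S xs f ℤ.+ S xs g
S-+ []       f g = refl
S-+ (x ∷ xs) f g = begin
  (f x ℤ.+ g x) ℤ.+ S xs (λ x → f x ℤ.+ g x)  ≡⟨ cong (ℤ._+_ (f x ℤ.+ g x)) (S-+ xs f g) ⟩
  (f x ℤ.+ g x) ℤ.+ (S xs f ℤ.+ S xs g)        ≡⟨ interchange ℤ.+-commutativeSemigroup (f x) (g x) _ _ ⟩
  (f x ℤ.+ S xs f) ℤ.+ (g x ℤ.+ S xs g)        ∎
  where
  open ≡-Reasoning

S-++ : ∀ (xs ys : List A) f → S (xs ++ ys) f ≡ S xs f ℤ.+ S ys f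
S-++ []       ys f = sym (ℤ.+-identityˡ _)
S-++ (x ∷ xs) ys f = trans (cong (ℤ._+_ (f x)) (S-++ xs ys f)) (sym (ℤ.+-assoc (f x) _ _))

S-↭ : ∀ {xs ys : List A} (f : A → ℤ) → xs ↭ ys → S xs f ≡ S ys f
S-↭ f _↭_.refl         = refl
S-↭ f (_↭_.prep x p)   = cong (ℤ._+_ (f x)) (S-↭ f p)
S-↭ f (_↭_.swap x y p) = trans (sym (ℤ.+-assoc (f x) (f y) _))
  (trans (cong₂ ℤ._+_ (ℤ.+-comm (f x) (f y)) (S-↭ f p)) (ℤ.+-assoc (f y) (f x) _))
S-↭ f (_↭_.trans p q)  = trans (S-↭ f p) (S-↭ f q)

S-indicator : {P : Pred A 0ℓ} (P? : Decidable P) (xs : List A) →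
  S xs (λ x → if does (P? x) then 1ℤ else 0ℤ) ≡ + length (filter P? xs)
S-indicator P? []       = refl
S-indicator P? (x ∷ xs) with P? x
... | yes _ = cong (ℤ._+_ 1ℤ) (S-indicator P? xs)
... | no _  = trans (ℤ.+-identityˡ _) (S-indicator P? xs)

module _ (_≟_ : DecidableEquality K) where

  S-delta-∉ : ∀ {k} ks (v : K → ℤ) → k ∉ ks →
    S ks (λ k′ → if does (k ≟ k′) then v k′ else 0ℤ) ≡ 0ℤ
  S-delta-∉ {k} ks v k∉ = trans (S-cong ks vanish) (S-zero ks)
    where
    vanish : ∀ {k′} → k′ ∈ ks → (if does (k ≟ k′) then v k′ else 0ℤ) ≡ 0ℤ
    vanish {k′} p with k ≟ k′
    ... | yes refl = ⊥-elim (k∉ p)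
    ... | no _     = refl

  S-delta : ∀ {k ks} (v : K → ℤ) → Unique ks → k ∈ ks →
    S ks (λ k′ → if does (k ≟ k′) then v k′ else 0ℤ) ≡ v k
  S-delta {k} v u@(_ ∷ _) (here {xs = ks} refl) with k ≟ k
  ... | yes _ = trans (cong (ℤ._+_ (v k)) (S-delta-∉ ks v (Unique.Unique[x∷xs]⇒x∉xs u))) (ℤ.+-identityʳ _)
  ... | no n  = ⊥-elim (n refl)
  S-delta {k} v (h ∷ u) (there {x = k′} p) with k ≟ k′
  ... | yes refl = ⊥-elim (All.lookup h p refl)
  ... | no _     = trans (ℤ.+-identityˡ _) (S-delta v u p)

  -- By induction on the list: the head term is a delta sum concentrated at its key, and adding it
  -- changes only the fibre over that key.
  S-group : (key : A → K) (g : A → ℤ) → ∀ ks → Unique ks → ∀ xs → All (λ x → key x ∈ ks) xs →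
    S xs g ≡ S ks (λ k → S (filter (λ x → key x ≟ k) xs) g)
  S-group key g ks u []       []       = sym (S-zero ks)
  S-group key g ks u (x ∷ xs) (p ∷ ps) = begin
    g x ℤ.+ S xs g
      ≡⟨ cong₂ ℤ._+_ (sym (S-delta (λ _ → g x) u p)) (S-group key g ks u xs ps) ⟩
    S ks (λ k → if does (key x ≟ k) then g x else 0ℤ) ℤ.+
    S ks (λ k → S (filter (λ x → key x ≟ k) xs) g)
      ≡⟨ S-+ ks _ _ ⟨
    S ks (λ k → (if does (key x ≟ k) then g x else 0ℤ) ℤ.+ S (filter (λ x → key x ≟ k) xs) g)
      ≡⟨ S-cong ks (λ {k} _ → step k) ⟩
    S ks (λ k → S (filter (λ x → key x ≟ k) (x ∷ xs)) g) ∎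
    where
    open ≡-Reasoning
    step : ∀ k → (if does (key x ≟ k) then g x else 0ℤ) ℤ.+ S (filter (λ x → key x ≟ k) xs) g
               ≡ S (filter (λ x → key x ≟ k) (x ∷ xs)) g
    step k with key x ≟ k
    ... | yes _ = refl
    ... | no _  = ℤ.+-identityˡ _

  multiplicity : List K → K → ℕ
  multiplicity ks k = length (filter (λ k′ → k′ ≟ k) ks)

  -- Collecting equal terms makes the coefficients multiplicities; this is where their nonnegativity
  -- comes from.
  S-multiplicity : ∀ {ks} (v : K → ℤ) → Unique ks → ∀ xs → All (_∈ ks) xs →
    S xs v ≡ S ks (λ k → + multiplicity xs k ℤ.* v k)
  S-multiplicity {ks} v u xs h =
    trans (S-group id v ks u xs h) (S-cong ks λ {k} _ → constant k xs)
    where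
    constant : ∀ k xs → S (filter (λ k′ → k′ ≟ k) xs) v ≡ + multiplicity xs k ℤ.* v k
    constant k []       = sym (ℤ.*-zeroˡ (v k))
    constant k (x ∷ xs) with x ≟ k
    ... | yes refl = trans (cong (ℤ._+_ (v x)) (constant x xs)) (sym (ℤ.suc-* (+ multiplicity xs x) (v x)))
    ... | no _     = constant k xs

-- Permutations and linear extensions

insertions⇒↭ : ∀ {x : A} xs {ρ} → ρ ∈ insertions x xs → ρ ↭ x ∷ xs
insertions⇒↭         []       (here refl) = ↭-refl
insertions⇒↭         (y ∷ ys) (here refl) = ↭-refl
insertions⇒↭ {x = x} (y ∷ ys) (there p) with ρ , q , refl ← ∈-map⁻ (y ∷_) p =
  ↭-trans (↭-prep y (insertions⇒↭ ys q)) (↭-swap y x ↭-refl)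

∈-insertions : ∀ (x : A) us vs → us ++ x ∷ vs ∈ insertions x (us ++ vs)
∈-insertions x []       []       = here refl
∈-insertions x []       (v ∷ vs) = here refl
∈-insertions x (u ∷ us) vs       = there (∈-map⁺ (u ∷_) (∈-insertions x us vs))

∈-permutations⁻ : ∀ (xs : List A) {π} → π ∈ permutations xs → π ↭ xs
∈-permutations⁻ []       (here refl) = ↭-refl
∈-permutations⁻ (x ∷ xs) p
  with ρs , q , r ← ∈-concat⁻′ (map (insertions x) (permutations xs)) p
  with ρ , ρ∈ , refl ← ∈-map⁻ (insertions x) r =
  ↭-trans (insertions⇒↭ ρ q) (↭-prep x (∈-permutations⁻ xs ρ∈))

∈-permutations⁺ : ∀ (xs : List A) {π} → π ↭ xs → π ∈ permutations xs
∈-permutations⁺ []       p with refl ← ↭-empty-inv p = here refl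
∈-permutations⁺ (x ∷ xs) p with us , vs , refl ← ∈-∃++ (∈-resp-↭ (↭-sym p) (here refl)) =
  ∈-concat⁺′ (∈-insertions x us vs)
    (∈-map⁺ (insertions x) (∈-permutations⁺ xs (drop-∷ (↭-trans (↭-sym (shift x us vs)) p))))

∉-resp-↭ : ∀ {x : A} {xs ys} → xs ↭ ys → x ∉ ys → x ∉ xs
∉-resp-↭ p x∉ q = x∉ (∈-resp-↭ p q)

insertions-unique : ∀ {x : A} xs → x ∉ xs → Unique (insertions x xs)
insertions-unique         []       x∉ = [] ∷ []
insertions-unique {x = x} (y ∷ ys) x∉ =
  All.tabulate (λ { p refl → x∉ (here (head (∈-map⁻ (y ∷_) p))) })
  ∷ Unique.map⁺ List.∷-injectiveʳ (insertions-unique ys (x∉ ∘ there))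
  where
  head : ∃ (λ ρ → ρ ∈ insertions x ys × x ∷ y ∷ ys ≡ y ∷ ρ) → x ≡ y
  head (_ , _ , e) = List.∷-injectiveˡ e

module _ (_≟_ : DecidableEquality A) where

  -- Gives the disjointness in `permutations-unique`: as deleting x recovers the list, insertions
  -- into distinct lists have no word in common.
  filter-insertions : ∀ {x} xs → x ∉ xs → ∀ {ρ} → ρ ∈ insertions x xs →
    filter (λ y → ¬? (y ≟ x)) ρ ≡ xs
  filter-insertions {x} [] x∉ (here refl) with x ≟ x
  ... | yes _ = refl
  ... | no n  = ⊥-elim (n refl)
  filter-insertions {x} (y ∷ ys) x∉ (here refl) with x ≟ x
  ... | yes _ = List.filter-all (λ z → ¬? (z ≟ x))
                  (All.tabulate λ p e → x∉ (subst (_∈ y ∷ ys) e p))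
  ... | no n  = ⊥-elim (n refl)
  filter-insertions {x} (y ∷ ys) x∉ (there p) with ρ , q , refl ← ∈-map⁻ (y ∷_) p with y ≟ x
  ... | yes e = ⊥-elim (x∉ (here (sym e)))
  ... | no _  = cong (y ∷_) (filter-insertions ys (x∉ ∘ there) q)

  permutations-unique : ∀ {xs} → Unique xs → Unique (permutations xs)
  permutations-unique {[]}     []          = [] ∷ []
  permutations-unique {x ∷ xs} u@(_ ∷ u′) = Unique.concat⁺
    (All.map⁺ (All.tabulate λ {ρ} p → insertions-unique ρ (fresh p)))
    (AllPairs.map⁺ (disjoint (All.tabulate fresh) (permutations-unique u′)))
    where
    fresh : ∀ {ρ} → ρ ∈ permutations xs → x ∉ ρ
    fresh p = ∉-resp-↭ (∈-permutations⁻ xs p) (Unique.Unique[x∷xs]⇒x∉xs u)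
    disjoint : ∀ {ρs} → All (x ∉_) ρs → Unique ρs → AllPairs
      (λ ρ ρ′ → ∀ {τ} → ¬ (τ ∈ insertions x ρ × τ ∈ insertions x ρ′)) ρs
    disjoint []       []       = []
    disjoint (f ∷ fs) (h ∷ hs) = All.zipWith (λ { (f′ , ne) (p , q) →
      ne (trans (sym (filter-insertions _ f p)) (filter-insertions _ f′ q)) }) (fs , h)
      ∷ disjoint fs hs

⊑-AllPairs : {R : Rel A 0ℓ} → ∀ {x y xs} → AllPairs R xs → x ∷ y ∷ [] ⊑ xs → R x y
⊑-AllPairs (h ∷ t) (z ∷ʳ s)   = ⊑-AllPairs t s
⊑-AllPairs (h ∷ t) (refl ∷ s) = All.lookup h (to∈ s)

AllPairs-⊑ : {R : Rel A 0ℓ} → ∀ {xs} → (∀ {x y} → x ∷ y ∷ [] ⊑ xs → R x y) → AllPairs R xs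
AllPairs-⊑ {xs = []}     h = []
AllPairs-⊑ {xs = x ∷ xs} h =
  All.tabulate (λ p → h (refl ∷ from∈ p)) ∷ AllPairs-⊑ (λ s → h (x ∷ʳ s))

⊑-total : ∀ {x y : A} {xs} → x ∈ xs → y ∈ xs → x ≢ y →
  x ∷ y ∷ [] ⊑ xs ⊎ y ∷ x ∷ [] ⊑ xs
⊑-total (here refl) (here refl) ne = ⊥-elim (ne refl)
⊑-total (here refl) (there q)   ne = inj₁ (refl ∷ from∈ q)
⊑-total (there p)   (here refl) ne = inj₂ (refl ∷ from∈ p)
⊑-total (there p)   (there q)   ne with ⊑-total p q ne
... | inj₁ s = inj₁ (_ ∷ʳ s)
... | inj₂ s = inj₂ (_ ∷ʳ s)

⊑-∈₂ : ∀ {x y : A} {xs} → x ∷ y ∷ [] ⊑ xs → y ∈ xs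
⊑-∈₂ (z ∷ʳ s)   = there (⊑-∈₂ s)
⊑-∈₂ (refl ∷ s) = there (to∈ s)

⊑-asym : ∀ {x y : A} {xs} → Unique xs → x ∷ y ∷ [] ⊑ xs → ¬ (y ∷ x ∷ [] ⊑ xs)
⊑-asym (h ∷ u) (z ∷ʳ s)   (z ∷ʳ t)   = ⊑-asym u s t
⊑-asym (h ∷ u) (z ∷ʳ s)   (refl ∷ t) = All.lookup h (⊑-∈₂ s) refl
⊑-asym (h ∷ u) (refl ∷ s) (z ∷ʳ t)   = All.lookup h (⊑-∈₂ t) refl
⊑-asym (h ∷ u) (refl ∷ s) (refl ∷ t) = All.lookup h (to∈ s) refl

↭-allFin-∈ : ∀ {π} → π ↭ allFin n → ∀ x → x ∈ π
↭-allFin-∈ p x = ∈-resp-↭ (↭-sym p) (∈-allFin x)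

↭-allFin-unique : ∀ {π} → π ↭ allFin n → Unique π
↭-allFin-unique {n} p = Unique-resp-↭ (setoid (Fin n)) (↭⇒↭ₛ (↭-sym p)) (Unique.allFin⁺ n)

module _ (P : FinPoset n) where
  open FinPoset P

  -- Equivalent to `IsLinearExtension` on a permutation of `allFin n`; as an `AllPairs` statement it
  -- can be zipped with the sortedness of the word under another relation.
  NoInversion : List (Fin n) → Set
  NoInversion = AllPairs (λ x y → ¬ (y ≺ x))

  linearExtension⇒noInversion : ∀ {π} → Unique π → IsLinearExtension P π → NoInversion π
  linearExtension⇒noInversion u le = AllPairs-⊑ λ {x} {y} s y≺x → ⊑-asym u s (le y x y≺x)

  noInversion⇒linearExtension : ∀ {π} → (∀ x → x ∈ π) → NoInversion π → IsLinearExtension P π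
  noInversion⇒linearExtension all ni x y x≺y
    with ⊑-total (all x) (all y) (λ e → irrefl e x≺y)
  ... | inj₁ s = s
  ... | inj₂ s = ⊥-elim (⊑-AllPairs ni s x≺y)

  ∈-linearExtensions⁻ : ∀ {π} → π ∈ linearExtensions P → π ↭ allFin n × NoInversion π
  ∈-linearExtensions⁻ {π} p with q , le ← ∈-filter⁻ (isLinearExtension? P) p =
    let r = ∈-permutations⁻ (allFin n) q
    in  r , linearExtension⇒noInversion (↭-allFin-unique r) le

  ∈-linearExtensions⁺ : ∀ {π} → π ↭ allFin n → NoInversion π → π ∈ linearExtensions P
  ∈-linearExtensions⁺ r ni = ∈-filter⁺ (isLinearExtension? P)
    (∈-permutations⁺ (allFin n) r)
    (noInversion⇒linearExtension (↭-allFin-∈ r) ni)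

  linearExtensions-unique : Unique (linearExtensions P)
  linearExtensions-unique =
    Unique.filter⁺ (isLinearExtension? P) (permutations-unique _≟F_ (Unique.allFin⁺ n))

-- Coefficients of the fundamental basis

compositions-unique : ∀ n → Unique (compositions n)
compositions-unique 0             = [] ∷ []
compositions-unique 1             = [] ∷ []
compositions-unique (suc (suc n)) = Unique.++⁺
  (Unique.map⁺ List.∷-injectiveʳ (compositions-unique (suc n)))
  (Unique.map⁺ incrHead-injective (compositions-unique (suc n)))
  disjoint
  where
  incrHead-injective : ∀ {α β} → incrHead α ≡ incrHead β → α ≡ β
  incrHead-injective {[]}    {[]}    e    = refl
  incrHead-injective {a ∷ α} {_ ∷ _} refl = refl
  disjoint : ∀ {γ} → ¬ (γ ∈ map (1 ∷_) (compositions (suc n)) ×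
                         γ ∈ map incrHead (compositions (suc n)))
  disjoint (p , q) with _ , _ , refl ← ∈-map⁻ (1 ∷_) p with ∈-map⁻ incrHead q
  ... | zero ∷ _ , r , refl with (() ∷ _) , _ ← All.lookup (compositions-sound (suc n)) r

flatten : Monomial → List ℕ
flatten = filter ℕ.nonZero?

-- Only the monomial basis element of `flatten e` involves the monomial e, and it occurs in the sum
-- once exactly when `flatten e` refines α.
L-coefficient : ∀ α e → L α e ≡ (if does (flatten e ≼? α) then 1ℤ else 0ℤ)
L-coefficient α e = by-cases (flatten e ≼? α)
  where
  by-cases : (d : Dec (flatten e ≼ α)) → L α e ≡ (if does d then 1ℤ else 0ℤ)
  by-cases (yes r) = S-delta (List.≡-dec ℕ._≟_) (λ _ → 1ℤ)
    (Unique.filter⁺ (_≼? α) (compositions-unique (sum α)))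
    (∈-filter⁺ (_≼? α) (compositions-complete (sum α) (All.all-filter ℕ.nonZero? e) (proj₁ r)) r)
  by-cases (no ¬r) = S-delta-∉ (List.≡-dec ℕ._≟_) _ (λ _ → 1ℤ)
    (λ p → ¬r (proj₂ (∈-filter⁻ (_≼? α) {xs = compositions (sum α)} p)))

adapted? : (ω : Labeling n) (β : List ℕ) → Decidable (λ π → β ≼ C (map (Labeling.label ω) π))
adapted? ω β π = β ≼? C (map (Labeling.label ω) π)

-- Coefficients are cardinalities, so two such series can be compared by injections in both
-- directions.
F-coefficient : ∀ (P : FinPoset n) ω e →
  F P ω e ≡ + length (filter (adapted? ω (flatten e)) (linearExtensions P))
F-coefficient P ω e =
  trans (S-cong (linearExtensions P) (λ {π} _ → L-coefficient (C (map (Labeling.label ω) π)) e))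
        (S-indicator (adapted? ω (flatten e)) (linearExtensions P))

-- Levels

-- The weakly increasing word with α₁ letters i, α₂ letters i + 1, and so on: the sorted values of a
-- (P, ω)-partition of content α.
lev : ℕ → List ℕ → List ℕ
lev i []      = []
lev i (a ∷ α) = replicate a i ++ lev (suc i) α

length-lev : ∀ i α → length (lev i α) ≡ sum α
length-lev i []          = refl
length-lev i (zero ∷ α)  = length-lev (suc i) α
length-lev i (suc a ∷ α) = cong suc (length-lev i (a ∷ α))

lev-≥ : ∀ i α → All (i ≤_) (lev i α)
lev-≥ i []          = []
lev-≥ i (zero ∷ α)  = All.map (ℕ.≤-trans (ℕ.n≤1+n i)) (lev-≥ (suc i) α)
lev-≥ i (suc a ∷ α) = ℕ.≤-refl ∷ lev-≥ i (a ∷ α)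

lev-sorted : ∀ i α → AllPairs _≤_ (lev i α)
lev-sorted i []          = []
lev-sorted i (zero ∷ α)  = lev-sorted (suc i) α
lev-sorted i (suc a ∷ α) = lev-≥ i (a ∷ α) ∷ lev-sorted i (a ∷ α)

-- No part of a composition is zero, so no level is passed over.
lev-gapless : ∀ {i j k} α → IsComposition α → k ∈ lev i α → i ≤ j → j ≤ k → j ∈ lev i α
lev-gapless {i} {j} (suc a ∷ α) (_ ∷ c) p i≤j j≤k with ℕ.m≤n⇒m<n∨m≡n i≤j
... | inj₂ refl = here refl
... | inj₁ i<j with ∈-++⁻ (replicate (suc a) i) p
...   | inj₁ q rewrite All.lookup (All.replicate⁺ {P = _≡ i} (suc a) refl) q =
        ⊥-elim (ℕ.n≮n _ (ℕ.<-≤-trans i<j j≤k))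
...   | inj₂ q = ∈-++⁺ʳ (replicate (suc a) i) (lev-gapless α c q i<j j≤k)

-- The value `b` is a default where the two lists give none.
assign : DecidableEquality A → B → List A → List B → A → B
assign _≟_ b (y ∷ ys) (k ∷ ks) x = if does (x ≟ y) then k else assign _≟_ b ys ks x
assign _≟_ b _        _        x = b

map-assign : ∀ (_≟_ : DecidableEquality A) (b : B) {ys ks} → Unique ys →
  length ys ≡ length ks → map (assign _≟_ b ys ks) ys ≡ ks
map-assign _≟_ b {[]}     {[]}     u e = refl
map-assign _≟_ b {y ∷ ys} {k ∷ ks} (h ∷ u) e = cong₂ _∷_ head
  (trans (List.map-cong-local (All.map tail h)) (map-assign _≟_ b u (ℕ.suc-injective e)))
  where
  head : assign _≟_ b (y ∷ ys) (k ∷ ks) y ≡ k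
  head with y ≟ y
  ... | yes _ = refl
  ... | no n  = ⊥-elim (n refl)
  tail : ∀ {x} → y ≢ x → assign _≟_ b (y ∷ ys) (k ∷ ks) x ≡ assign _≟_ b ys ks x
  tail {x} n with x ≟ y
  ... | yes refl = ⊥-elim (n refl)
  ... | no _     = refl

-- Lexicographic order by level, then by label

Lex : (f ω : A → ℕ) → Rel A 0ℓ
Lex f ω x y = f x < f y ⊎ (f x ≡ f y × ω x < ω y)

module _ {f ω : A → ℕ} where

  Lex-trans : Transitive (Lex f ω)
  Lex-trans (inj₁ p)       (inj₁ q)       = inj₁ (ℕ.<-trans p q)
  Lex-trans (inj₁ p)       (inj₂ (e , _)) = inj₁ (ℕ.<-≤-trans p (ℕ.≤-reflexive e))
  Lex-trans (inj₂ (e , _)) (inj₁ q)       = inj₁ (ℕ.≤-<-trans (ℕ.≤-reflexive e) q)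
  Lex-trans (inj₂ (d , p)) (inj₂ (e , q)) = inj₂ (trans d e , ℕ.<-trans p q)

  Lex-irrefl : ∀ {x} → ¬ Lex f ω x x
  Lex-irrefl (inj₁ p)       = ℕ.n≮n _ p
  Lex-irrefl (inj₂ (_ , p)) = ℕ.n≮n _ p

  Lex-asym : ∀ {x y} → Lex f ω x y → ¬ Lex f ω y x
  Lex-asym p q = Lex-irrefl (Lex-trans p q)

  Lex⇒≤ : ∀ {x y} → Lex f ω x y → f x ≤ f y
  Lex⇒≤ (inj₁ p)       = ℕ.<⇒≤ p
  Lex⇒≤ (inj₂ (e , _)) = ℕ.≤-reflexive e

  Lex-total : ∀ {x y} → ω x ≢ ω y → Lex f ω x y ⊎ Lex f ω y x
  Lex-total {x} {y} ne with ℕ.<-cmp (f x) (f y) | ℕ.<-cmp (ω x) (ω y)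
  ... | tri< p _ _ | _          = inj₁ (inj₁ p)
  ... | tri> _ _ p | _          = inj₂ (inj₁ p)
  ... | tri≈ _ e _ | tri< p _ _ = inj₁ (inj₂ (e , p))
  ... | tri≈ _ e _ | tri> _ _ p = inj₂ (inj₂ (sym e , p))
  ... | tri≈ _ e _ | tri≈ _ d _ = ⊥-elim (ne d)

-- Runs

C-∷ : ∀ x π → ∃ λ a → ∃ λ γ → C (x ∷ π) ≡ suc a ∷ γ
C-∷ x []      = 0 , [] , refl
C-∷ x (y ∷ π) with does (x ℕ.<? y) | C-∷ y π
... | true  | a , γ , e = suc a , γ , cong incrHead e
... | false | _         = 0 , _ , refl

C-composition : ∀ π → IsComposition (C π)
C-composition []          = []
C-composition (x ∷ [])    = nonZero ∷ []
C-composition (x ∷ y ∷ π) with does (x ℕ.<? y) | C-composition (y ∷ π) | C-∷ y π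
... | false | c | _         = nonZero ∷ c
... | true  | c | a , γ , e rewrite e with _ ∷ c′ ← c = nonZero ∷ c′

sum-C : ∀ π → sum (C π) ≡ length π
sum-C []          = refl
sum-C (x ∷ [])    = refl
sum-C (x ∷ y ∷ π) with does (x ℕ.<? y) | sum-C (y ∷ π) | C-∷ y π
... | false | s | _         = cong suc s
... | true  | s | a , γ , e rewrite e = cong suc s

pps : List ℕ → List ℕ
pps = properPartialSums

pps-incrHead : ∀ γ → pps (incrHead γ) ≡ map suc (pps γ)
pps-incrHead []          = refl
pps-incrHead (a ∷ [])    = refl
pps-incrHead (a ∷ b ∷ γ) = cong (suc a ∷_) (List.map-∘ (pps (b ∷ γ)))

0∉pps : ∀ {γ} → IsComposition γ → 0 ∉ pps γ
0∉pps {suc a ∷ b ∷ γ} (_ ∷ c) (there p) with _ , _ , () ← ∈-map⁻ (_+_ (suc a)) p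

infix 4 _⊆ˢ_
_⊆ˢ_ : Rel (List ℕ) 0ℓ
xs ⊆ˢ ys = ∀ {x} → x ∈ xs → x ∈ ys

map-suc-⊆ : ∀ {xs ys} → map suc xs ⊆ˢ map suc ys → xs ⊆ˢ ys
map-suc-⊆ h p with _ , q , refl ← ∈-map⁻ suc (h (∈-map⁺ suc p)) = q

map-suc-⊆-∷ : ∀ {xs ys} → 0 ∉ xs → map suc xs ⊆ˢ 1 ∷ map suc ys → xs ⊆ˢ ys
map-suc-⊆-∷ 0∉ h p with h (∈-map⁺ suc p)
... | here refl = ⊥-elim (0∉ p)
... | there q with _ , r , refl ← ∈-map⁻ suc q = r

map-suc-⊆⁺ : ∀ {xs ys} → xs ⊆ˢ ys → map suc xs ⊆ˢ map suc ys
map-suc-⊆⁺ h p with _ , q , refl ← ∈-map⁻ suc p = ∈-map⁺ suc (h q)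

pps-C-< : ∀ {x y} π → x < y → pps (C (x ∷ y ∷ π)) ≡ map suc (pps (C (y ∷ π)))
pps-C-< {x} {y} π p rewrite dec-true (x ℕ.<? y) p = pps-incrHead (C (y ∷ π))

pps-C-≮ : ∀ {x y} π → ¬ (x < y) → pps (C (x ∷ y ∷ π)) ≡ 1 ∷ map suc (pps (C (y ∷ π)))
pps-C-≮ {x} {y} π p rewrite dec-false (x ℕ.<? y) p with C-∷ y π
... | a , γ , e rewrite e = refl

module _ (f ω : A → ℕ) where

  -- Follows π letter by letter, the head of β counting the letters left on the current level. At a
  -- head of 1 the next letter is a level higher. At a larger head the level stays, and since 1 is
  -- then no proper partial sum of β, the labels have to ascend.
  pps-C⇒Linked : ∀ {i} π β → IsComposition β → map f π ≡ lev i β →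
    pps (C (map ω π)) ⊆ˢ pps β → Linked (Lex f ω) π
  pps-C⇒Linked []          β c e h = []
  pps-C⇒Linked (x ∷ [])    β c e h = [-]
  pps-C⇒Linked (x ∷ y ∷ π) (1 ∷ suc b ∷ β) (_ ∷ c) e h =
    inj₁ (subst₂ _<_ (sym (List.∷-injectiveˡ e)) (sym (List.∷-injectiveˡ (List.∷-injectiveʳ e))) ℕ.≤-refl)
    ∷ pps-C⇒Linked (y ∷ π) (suc b ∷ β) c (List.∷-injectiveʳ e) tail
    where
    tail : pps (C (map ω (y ∷ π))) ⊆ˢ pps (suc b ∷ β)
    tail with ω x ℕ.<? ω y
    ... | yes p rewrite pps-C-< (map ω π) p = map-suc-⊆-∷ (0∉pps (C-composition (map ω (y ∷ π)))) h
    ... | no ¬p rewrite pps-C-≮ (map ω π) ¬p =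
      map-suc-⊆-∷ (0∉pps (C-composition (map ω (y ∷ π)))) (h ∘ there)
  pps-C⇒Linked (x ∷ y ∷ π) (1 ∷ zero ∷ β) (_ ∷ () ∷ _) e h
  pps-C⇒Linked (x ∷ y ∷ π) (suc (suc b) ∷ β) (_ ∷ c) e h =
    inj₂ (trans (List.∷-injectiveˡ e) (sym (List.∷-injectiveˡ (List.∷-injectiveʳ e))) , ascent)
    ∷ pps-C⇒Linked (y ∷ π) (suc b ∷ β) (nonZero ∷ c) (List.∷-injectiveʳ e) (map-suc-⊆ h″)
    where
    h′ : pps (C (ω x ∷ ω y ∷ map ω π)) ⊆ˢ map suc (pps (suc b ∷ β))
    h′ = subst (_ ∈_) (pps-incrHead (suc b ∷ β)) ∘ h
    ascent : ω x < ω y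
    -- A descent would make 1 a partial sum of the runs, and hence 0 a proper partial sum of the
    -- composition `suc b ∷ β`.
    ascent with ω x ℕ.<? ω y
    ... | yes p = p
    ... | no ¬p with _ , q , refl ← ∈-map⁻ suc
                     (h′ (subst (1 ∈_) (sym (pps-C-≮ (map ω π) ¬p)) (here refl))) =
      ⊥-elim (0∉pps {suc b ∷ β} (nonZero ∷ c) q)
    h″ : map suc (pps (C (ω y ∷ map ω π))) ⊆ˢ map suc (pps (suc b ∷ β))
    h″ = h′ ∘ subst (_ ∈_) (sym (pps-C-< (map ω π) ascent))

  -- Only descents of the labels produce partial sums of the runs, and a word increasing for `Lex`
  -- descends only where the level rises.
  Linked⇒pps-C : ∀ {i} π β → IsComposition β → map f π ≡ lev i β →
    Linked (Lex f ω) π → pps (C (map ω π)) ⊆ˢ pps β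
  Linked⇒pps-C (x ∷ y ∷ π) (1 ∷ zero ∷ β) (_ ∷ () ∷ _) e l
  Linked⇒pps-C (x ∷ y ∷ π) (1 ∷ suc b ∷ β) (_ ∷ c) e (_ ∷ l) with ω x ℕ.<? ω y
    | Linked⇒pps-C (y ∷ π) (suc b ∷ β) c (List.∷-injectiveʳ e) l
  ... | yes p | h rewrite pps-C-< (map ω π) p = there ∘ map-suc-⊆⁺ h
  ... | no ¬p | h rewrite pps-C-≮ (map ω π) ¬p =
    λ { (here refl) → here refl ; (there q) → there (map-suc-⊆⁺ h q) }
  Linked⇒pps-C (x ∷ y ∷ π) (suc (suc b) ∷ β) (_ ∷ c) e (s ∷ l)
    with s | Linked⇒pps-C (y ∷ π) (suc b ∷ β) (nonZero ∷ c) (List.∷-injectiveʳ e) l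
  ... | inj₁ p       | h = ⊥-elim (ℕ.<⇒≢ p
          (trans (List.∷-injectiveˡ e) (sym (List.∷-injectiveˡ (List.∷-injectiveʳ e)))))
  ... | inj₂ (_ , p) | h rewrite pps-C-< (map ω π) p | pps-incrHead (suc b ∷ β) = map-suc-⊆⁺ h

  Lex-sorted⇒≼ : ∀ {π β} → IsComposition β → map f π ≡ lev 0 β →
    AllPairs (Lex f ω) π → β ≼ C (map ω π)
  Lex-sorted⇒≼ {π} {β} c e s =
    trans (sym (length-lev 0 β)) (trans (cong length (sym e))
      (trans (List.length-map f π) (trans (sym (List.length-map ω π)) (sym (sum-C (map ω π))))))
    , Linked⇒pps-C π β c e (Linked.AllPairs⇒Linked s)

-- The function f writes the levels of β along π in order; refinement says that the labels descend
-- at level changes only.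
≼⇒Lex-sorted : ∀ (ω : Fin n → ℕ) {π β} → IsComposition β → Unique π → β ≼ C (map ω π) →
  ∃ λ f → map f π ≡ lev 0 β × AllPairs (Lex f ω) π
≼⇒Lex-sorted ω {π} {β} c u (s , h) = f , e , Linked.Linked⇒AllPairs
    (λ {x} {y} {z} → Lex-trans {f = f} {ω} {x} {y} {z}) (pps-C⇒Linked f ω π β c e h)
  where
  f = assign _≟F_ 0 π (lev 0 β)
  e : map f π ≡ lev 0 β
  e = map-assign _≟F_ 0 u (trans (sym (List.length-map ω π))
        (trans (sym (sum-C (map ω π))) (trans (sym s) (sym (length-lev 0 β)))))

-- Invariance under relabeling

↭-allFin : ∀ {π : List (Fin n)} → Unique π → (∀ x → x ∈ π) → π ↭ allFin n
↭-allFin {n} u all = ∼bag⇒↭ (unique∧set⇒bag u (Unique.allFin⁺ n)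
  (mk⇔ (λ _ → ∈-allFin _) (λ _ → all _)))

-- Ascents alone are compared: the labels in use are injective and x ≺ y excludes x = y, so
-- agreement on descents follows.
AgreeAt : FinPoset n → (ω ω′ : Fin n → ℕ) → Rel (Fin n) 0ℓ
AgreeAt P ω ω′ x y = FinPoset._≺_ P x y × (ω x < ω y ⇔ ω′ x < ω′ y)

record _≅_ (P : FinPoset m) (Q : FinPoset n) : Set where
  private
    module P = FinPoset P
    module Q = FinPoset Q
  field
    to       : Fin m → Fin n
    from     : Fin n → Fin m
    from-to  : ∀ x → from (to x) ≡ x
    to-from  : ∀ y → to (from y) ≡ y
    to-≺     : ∀ {x y} → x P.≺ y → to x Q.≺ to y
    from-≺   : ∀ {x y} → x Q.≺ y → from x P.≺ from y

≅-sym : ∀ {P : FinPoset m} {Q : FinPoset n} → P ≅ Q → Q ≅ P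
≅-sym i = record
  { to = from ; from = to ; from-to = to-from ; to-from = from-to
  ; to-≺ = from-≺ ; from-≺ = to-≺ }
  where open _≅_ i

≅-refl : ∀ {P : FinPoset n} → P ≅ P
≅-refl = record
  { to = id ; from = id ; from-to = λ _ → refl ; to-from = λ _ → refl
  ; to-≺ = id ; from-≺ = id }

-- The labelings need only agree on a relation generating the order, because
-- the conditions defining a (P, ω)-partition propagate along chains.
Compatible : (P : FinPoset m) (Q : FinPoset n) → P ≅ Q → Labeling m → Labeling n → Set
Compatible P Q i ω ω′ = ∀ {x y} → FinPoset._≺_ P x y →
  TransClosure (AgreeAt P (Labeling.label ω) (Labeling.label ω′ ∘ _≅_.to i)) x y

plus-map : ∀ {R : Rel A 0ℓ} {T : Rel B 0ℓ} (f : A → B) →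
  (∀ {x y} → R x y → T (f x) (f y)) → ∀ {x y} → TransClosure R x y → TransClosure T (f x) (f y)
plus-map f h [ r ]   = [ h r ]
plus-map f h (r ∷ p) = h r ∷ plus-map f h p

Compatible-sym : ∀ {P : FinPoset m} {Q : FinPoset n} (i : P ≅ Q) {ω ω′} →
  Compatible P Q i ω ω′ → Compatible Q P (≅-sym i) ω′ ω
Compatible-sym {P = P} {Q} i {ω} {ω′} c {x} {y} x≺y =
  subst₂ (TransClosure Agree′) (to-from x) (to-from y) (plus-map to step (c (from-≺ x≺y)))
  where
  open _≅_ i
  open Labeling
  Agree′ = AgreeAt Q (label ω′) (label ω ∘ from)
  step : ∀ {x y} → AgreeAt P (label ω) (label ω′ ∘ to) x y → Agree′ (to x) (to y)
  step {x} {y} (r , e) rewrite from-to x | from-to y =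
    to-≺ r , mk⇔ (Equivalence.from e) (Equivalence.to e)

-- The adapted linear extensions of P correspond to the order preserving
-- level functions f that are strict wherever ω descends; sorting by f and
-- the new labels recovers an adapted linear extension of Q.
module _ {P : FinPoset m} {Q : FinPoset n} (i : P ≅ Q) (ω : Labeling m) (ω′ : Labeling n)
         (compat : Compatible P Q i ω ω′) {β : List ℕ} (β-comp : IsComposition β) where
  private
    module P = FinPoset P
    module Q = FinPoset Q
    open _≅_ i
    open Labeling

    Adapted : ∀ {k} → FinPoset k → Labeling k → List (List (Fin k))
    Adapted R ν = filter (adapted? ν β) (linearExtensions R)

    -- Both words come from one level function f on P: it sorts π, and its transport along `from`
    -- reads `lev 0 β` along π′.
    Matches : List (Fin m) → List (Fin n) → Set
    Matches π π′ = ∃ λ f →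
      AllPairs (Lex f (label ω)) π × map (f ∘ from) π′ ≡ lev 0 β × π′ ↭ allFin n

    adapted⁻ : ∀ {π} → π ∈ Adapted P ω → π ↭ allFin m
    adapted⁻ p = proj₁ (∈-linearExtensions⁻ P
      (proj₁ (∈-filter⁻ (adapted? ω β) {xs = linearExtensions P} p)))

    match-exists : ∀ {π} → π ∈ Adapted P ω → ∃ λ π′ → π′ ∈ Adapted Q ω′ × Matches π π′
    match-exists {π} p
      with le , ad ← ∈-filter⁻ (adapted? ω β) {xs = linearExtensions P} p
      with perm , ni ← ∈-linearExtensions⁻ P le
      with f , f-lev , f-sorted ← ≼⇒Lex-sorted (label ω) β-comp (↭-allFin-unique perm) ad =
      π′ , ∈-filter⁺ (adapted? ω′ β)
             (∈-linearExtensions⁺ Q perm′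
               (AllPairs.map (λ s r → Lex-asym {f = f′} {label ω′} s (≺⇒Lex′ r)) s′))
             (Lex-sorted⇒≼ f′ (label ω′) β-comp f′-lev s′)
         , f , f-sorted , f′-lev , perm′
      where
      f′ = f ∘ from

      -- Two distinct letters are `Lex`-ordered as they stand in π, and a linear extension of P
      -- cannot have y before x.
      ≺⇒Lex : ∀ {x y} → x P.≺ y → Lex f (label ω) x y
      ≺⇒Lex {x} {y} r with ∈-AllPairs₂ (AllPairs.zip (f-sorted , ni))
                             (↭-allFin-∈ perm x) (↭-allFin-∈ perm y)
      ... | inj₁ refl           = ⊥-elim (P.irrefl refl r)
      ... | inj₂ (inj₁ (l , _)) = l
      ... | inj₂ (inj₂ (_ , n)) = ⊥-elim (n r)

      agree⇒Lex′ : ∀ {x y} → AgreeAt P (label ω) (label ω′ ∘ to) x y →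
                   Lex f′ (label ω′) (to x) (to y)
      agree⇒Lex′ {x} {y} (r , e) rewrite from-to x | from-to y with ≺⇒Lex r
      ... | inj₁ l       = inj₁ l
      ... | inj₂ (q , l) = inj₂ (q , Equivalence.to e l)

      chain⇒Lex′ : ∀ {x y} → TransClosure (AgreeAt P (label ω) (label ω′ ∘ to)) x y →
                   Lex f′ (label ω′) (to x) (to y)
      chain⇒Lex′ [ r ]                   = agree⇒Lex′ r
      chain⇒Lex′ {x} {y} (_∷_ {y = z} r c) =
        Lex-trans {f = f′} {label ω′} {to x} {to z} {to y} (agree⇒Lex′ r) (chain⇒Lex′ c)

      ≺⇒Lex′ : ∀ {x y} → x Q.≺ y → Lex f′ (label ω′) x y
      ≺⇒Lex′ {x} {y} r = subst₂ (Lex f′ (label ω′)) (to-from x) (to-from y)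
        (chain⇒Lex′ (compat (from-≺ r)))

      unique-to : Unique (map to π)
      unique-to = Unique.map⁺ (λ {x} {y} e → trans (sym (from-to x)) (trans (cong from e) (from-to y)))
        (↭-allFin-unique perm)

      perm-to : map to π ↭ allFin n
      perm-to = ↭-allFin unique-to λ y →
        subst (_∈ map to π) (to-from y) (∈-map⁺ to (↭-allFin-∈ perm (from y)))

      sorted = sort (λ {x} {y} {z} → Lex-trans {f = f′} {label ω′} {x} {y} {z})
        (AllPairs.map (λ ne → Lex-total {f = f′} (ne ∘ injective ω′)) unique-to)
      π′ = proj₁ sorted
      s′ = proj₂ (proj₂ sorted)

      perm′ : π′ ↭ allFin n
      perm′ = ↭-trans (proj₁ (proj₂ sorted)) perm-to

      -- The levels along π′ are a rearrangement of those along π, and both words are weakly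
      -- increasing.
      f′-lev : map f′ π′ ≡ lev 0 β
      f′-lev = sorted-unique ℕ.≤-antisym
        (AllPairs.map⁺ (AllPairs.map (Lex⇒≤ {f = f′} {label ω′}) s′)) (lev-sorted 0 β)
        (↭-trans (map⁺ f′ (proj₁ (proj₂ sorted))) (↭-reflexive
          (trans (sym (List.map-∘ π)) (trans (List.map-cong (cong f ∘ from-to) π) f-lev))))

    -- Since π′ lists every element of Q, the levels along it determine f, and only one permutation
    -- is sorted by f and ω.
    matches-injective : ∀ {π₁ π₂ π′} → π₁ ∈ Adapted P ω → π₂ ∈ Adapted P ω →
      Matches π₁ π′ → Matches π₂ π′ → π₁ ≡ π₂
    matches-injective p₁ p₂ (f₁ , s₁ , l₁ , q) (f₂ , s₂ , l₂ , _) =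
      sorted-unique (λ a b → ⊥-elim (Lex-asym {f = f₂} {label ω} a b))
        (AllPairs.map transfer s₁) s₂ (↭-trans (adapted⁻ p₁) (↭-sym (adapted⁻ p₂)))
      where
      same : ∀ x → f₁ x ≡ f₂ x
      same x = subst (λ z → f₁ z ≡ f₂ z) (from-to x)
        (map-≡-∈ (trans l₁ (sym l₂)) (↭-allFin-∈ q (to x)))
      transfer : ∀ {x y} → Lex f₁ (label ω) x y → Lex f₂ (label ω) x y
      transfer {x} {y} l rewrite same x | same y = l

  adapted-length-≤ : length (filter (adapted? ω β) (linearExtensions P)) ≤
                     length (filter (adapted? ω′ β) (linearExtensions Q))
  adapted-length-≤ = relation-length-≤ Matches (Adapted P ω) (Adapted Q ω′)
    (Unique.filter⁺ (adapted? ω β) (linearExtensions-unique P)) match-exists matches-injective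

-- The inequality between the counts is applied to the isomorphism and to its inverse.
F-cong : ∀ {P : FinPoset m} {Q : FinPoset n} (i : P ≅ Q) (ω : Labeling m) (ω′ : Labeling n) →
  Compatible P Q i ω ω′ → F P ω ≈ F Q ω′
F-cong {P = P} {Q} i ω ω′ compat e = begin
  F P ω e                                                         ≡⟨ F-coefficient P ω e ⟩
  + length (filter (adapted? ω (flatten e)) (linearExtensions P))  ≡⟨ cong +_ (ℕ.≤-antisym
    (adapted-length-≤ i ω ω′ compat comp)
    (adapted-length-≤ (≅-sym i) ω′ ω (Compatible-sym i {ω} {ω′} compat) comp)) ⟩
  + length (filter (adapted? ω′ (flatten e)) (linearExtensions Q)) ≡⟨ F-coefficient Q ω′ e ⟨
  F Q ω′ e                                                        ∎
  where
  open ≡-Reasoning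
  comp : IsComposition (flatten e)
  comp = All.all-filter ℕ.nonZero? e

-- Chains of antichains

-- Levels start at 0 and parts at 1, so `true` marks the blocks A₁, A₃, and so on, which will lie in
-- the basis.
par : ℕ → Bool
par zero    = true
par (suc i) = not (par i)

block : ℕ → ∀ α → Fin (sum α) → ℕ
block i (a ∷ α) x with splitAt a x
... | inj₁ _ = i
... | inj₂ y = block (suc i) α y

block-≥ : ∀ i α x → i ≤ block i α x
block-≥ i (a ∷ α) x with splitAt a x
... | inj₁ _ = ℕ.≤-refl
... | inj₂ y = ℕ.≤-trans (ℕ.n≤1+n i) (block-≥ (suc i) α y)

≺⇒block-< : ∀ i α {x y} → FinPoset._≺_ (chainOfAntichains α) x y → block i α x < block i α y
≺⇒block-< i (a ∷ α) {x} {y} r with splitAt a x | splitAt a y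
≺⇒block-< i (a ∷ α) ₁∼₂     | inj₁ _ | inj₂ w = block-≥ (suc i) α w
≺⇒block-< i (a ∷ α) (₂∼₂ r) | inj₂ _ | inj₂ _ = ≺⇒block-< (suc i) α r

block-<⇒≺ : ∀ i α {x y} → block i α x < block i α y → FinPoset._≺_ (chainOfAntichains α) x y
block-<⇒≺ i (a ∷ α) {x} {y} r with splitAt a x | splitAt a y
... | inj₁ _ | inj₁ _ = ⊥-elim (ℕ.n≮n i r)
... | inj₁ _ | inj₂ _ = ₁∼₂
... | inj₂ v | inj₁ _ = ⊥-elim (ℕ.n≮n i (ℕ.≤-trans (block-≥ (suc i) α v) (ℕ.<⇒≤ r)))
... | inj₂ _ | inj₂ _ = ₂∼₂ (block-<⇒≺ (suc i) α r)

tabulate-block : ∀ i α → tabulate (block i α) ≡ lev i α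
tabulate-block i []          = refl
tabulate-block i (zero ∷ α)  = tabulate-block (suc i) α
tabulate-block i (suc a ∷ α) =
  cong (i ∷_) (trans (List.tabulate-cong step) (tabulate-block i (a ∷ α)))
  where
  step : ∀ x → block i (suc a ∷ α) (Fin.suc x) ≡ block i (a ∷ α) x
  step x with splitAt a x
  ... | inj₁ _ = refl
  ... | inj₂ _ = refl

map-block : ∀ α → map (block 0 α) (allFin (sum α)) ≡ lev 0 α
map-block α = trans (List.map-tabulate id (block 0 α)) (tabulate-block 0 α)

-- The recursion of `numbering` swaps its two counters at each antichain while `par` flips, so the
-- parity of the block tells which counter numbered x.
numbering-bounds : ∀ i s t α x → let v = numbering s t α x in
  (par (block i α x) ≡ par i × s ≤ v × v < s + rank α) ⊎
  (par (block i α x) ≡ not (par i) × t ≤ v × v < t + evenSum α)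
numbering-bounds i s t (a ∷ α) x with splitAt a x
... | inj₁ j = inj₁ (refl , ℕ.m≤m+n s _ ,
        ℕ.+-monoʳ-< s (ℕ.<-≤-trans (toℕ<n j) (ℕ.m≤m+n a _)))
... | inj₂ y with numbering-bounds (suc i) t (s + a) α y
...   | inj₁ p           = inj₂ p
...   | inj₂ (e , p , q) = inj₁ (trans e (Bool.not-involutive (par i)) ,
          ℕ.≤-trans (ℕ.m≤m+n s a) p , ℕ.<-≤-trans q (ℕ.≤-reflexive (ℕ.+-assoc s a _)))

-- The labels of A₂, A₄, and so on end before `suc (evenSum α)`, where those of A₁, A₃, and so on
-- begin.
labeling-< : ∀ α {x y} → par (block 0 α x) ≡ true → par (block 0 α y) ≡ false →
  Labeling.label (labeling α) y < Labeling.label (labeling α) x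
labeling-< α {x} {y} p q
  with numbering-bounds 0 (suc (evenSum α)) 1 α x | numbering-bounds 0 (suc (evenSum α)) 1 α y
... | inj₂ (p′ , _) | _ with () ← trans (sym p) p′
... | inj₁ (_ , l , _) | inj₂ (_ , _ , u) = ℕ.<-≤-trans u l
... | inj₁ _ | inj₁ (q′ , _) with () ← trans (sym q) q′

-- Runs of equal letters

runs : List Bool → List ℕ
runs []           = []
runs (s ∷ [])     = 1 ∷ []
runs (s ∷ t ∷ ss) = if does (s Bool.≟ t) then incrHead (runs (t ∷ ss)) else 1 ∷ runs (t ∷ ss)

runs-∷ : ∀ s ss → ∃ λ a → ∃ λ γ → runs (s ∷ ss) ≡ suc a ∷ γ
runs-∷ s []       = 0 , [] , refl
runs-∷ s (t ∷ ss) with does (s Bool.≟ t) | runs-∷ t ss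
... | true  | a , γ , e = suc a , γ , cong incrHead e
... | false | _         = 0 , _ , refl

runs-composition : ∀ ss → IsComposition (runs ss)
runs-composition []           = []
runs-composition (s ∷ [])     = nonZero ∷ []
runs-composition (s ∷ t ∷ ss) with does (s Bool.≟ t) | runs-composition (t ∷ ss) | runs-∷ t ss
... | false | c | _         = nonZero ∷ c
... | true  | c | a , γ , e rewrite e with _ ∷ c′ ← c = nonZero ∷ c′

sum-runs : ∀ ss → sum (runs ss) ≡ length ss
sum-runs []           = refl
sum-runs (s ∷ [])     = refl
sum-runs (s ∷ t ∷ ss) with does (s Bool.≟ t) | sum-runs (t ∷ ss) | runs-∷ t ss
... | false | s′ | _         = cong suc s′
... | true  | s′ | a , γ , e rewrite e = cong suc s′

-- Consecutive runs carry opposite letters and consecutive levels opposite parities, so it is enough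
-- that the two match at the start.
map-par-lev : ∀ i s ss → par i ≡ s → map par (lev i (runs (s ∷ ss))) ≡ s ∷ ss
map-par-lev i s []       refl = refl
map-par-lev i s (t ∷ ss) p with s Bool.≟ t | runs-∷ t ss
... | yes refl | a , γ , e with ih ← map-par-lev i s ss p rewrite e = cong₂ _∷_ p ih
... | no s≢t   | _          = cong₂ _∷_ p (map-par-lev (suc i) t ss
  (trans (cong not p) (sym (Bool.¬-not (s≢t ∘ sym)))))

trues : List Bool → ℕ
trues ss = length (filter (Bool._≟ true) ss)

-- Runs alternate between the letters, so those of `true` are the odd-indexed ones if the word
-- begins with `true` and the even-indexed ones otherwise.
rank-runs : ∀ s ss → (if s then rank (runs (s ∷ ss)) else evenSum (runs (s ∷ ss))) ≡ trues (s ∷ ss)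
rank-runs true  []           = refl
rank-runs false []           = refl
rank-runs true  (false ∷ ss) = cong suc (rank-runs false ss)
rank-runs false (true ∷ ss)  = rank-runs true ss
rank-runs true  (true ∷ ss)  with runs-∷ true ss | rank-runs true ss
... | a , γ , e | ih rewrite e = cong suc ih
rank-runs false (false ∷ ss) with runs-∷ false ss | rank-runs false ss
... | a , γ , e | ih rewrite e = ih

-- Expansion of posets of height two

module _ {m n} {f : Fin m → ℕ} {g : Fin n → ℕ} {π ρ} (π-perm : π ↭ allFin m) (ρ-perm : ρ ↭ allFin n)
         (e : map f π ≡ map g ρ) where
  private
    zs = proj₁ (pairing π ρ e)
    fst≡ = proj₁ (proj₂ (pairing π ρ e))
    snd≡ = proj₁ (proj₂ (proj₂ (pairing π ρ e)))
    equal = proj₂ (proj₂ (proj₂ (pairing π ρ e)))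

    image : ∀ x → ∃ λ z → z ∈ zs × x ≡ proj₁ z
    image x = ∈-map⁻ proj₁ (subst (x ∈_) (sym fst≡) (↭-allFin-∈ π-perm x))

    preimage : ∀ y → ∃ λ z → z ∈ zs × y ≡ proj₂ z
    preimage y = ∈-map⁻ proj₂ (subst (y ∈_) (sym snd≡) (↭-allFin-∈ ρ-perm y))

    to : Fin m → Fin n
    to x = proj₂ (proj₁ (image x))

    from : Fin n → Fin m
    from y = proj₁ (proj₁ (preimage y))

    unique₁ : ∀ {z z′} → z ∈ zs → z′ ∈ zs → proj₁ z ≡ proj₁ z′ → z ≡ z′
    unique₁ = unique-map-injective (subst Unique (sym fst≡) (↭-allFin-unique π-perm))

    unique₂ : ∀ {z z′} → z ∈ zs → z′ ∈ zs → proj₂ z ≡ proj₂ z′ → z ≡ z′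
    unique₂ = unique-map-injective (subst Unique (sym snd≡) (↭-allFin-unique ρ-perm))

  -- Letters at equal positions of π and ρ are paired; as each word lists every element once, the
  -- pairs are the graph of a bijection.
  matching : ∃ λ (to : Fin m → Fin n) → ∃ λ (from : Fin n → Fin m) →
    (∀ x → from (to x) ≡ x) × (∀ y → to (from y) ≡ y) × (∀ x → f x ≡ g (to x))
  matching = to , from , from-to , to-from , level
    where
    from-to : ∀ x → from (to x) ≡ x
    from-to x with (_ , p , refl) ← image x | (_ , q , r) ← preimage (to x) =
      cong proj₁ (unique₂ q p (sym r))
    to-from : ∀ y → to (from y) ≡ y
    to-from y with (_ , p , refl) ← preimage y | (_ , q , r) ← image (from y) =
      cong proj₂ (unique₁ q p (sym r))
    level : ∀ x → f x ≡ g (to x)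
    level x with image x
    ... | z , p , refl = All.lookup equal p

-- Concatenating index lists adds the series. It serves first for the ordered partitions of one
-- poset, then for the bases of the matroid.
collect : (I : List ℕ → Set) (ks : List K) (G : K → Series) →
  (∀ {k} → k ∈ ks → ∃ λ αs → All I αs × G k ≈ ∑ αs N) →
  ∃ λ αs → All I αs × ∑ ks G ≈ ∑ αs N
collect I []       G h = [] , [] , λ _ → refl
collect I (k ∷ ks) G h with αs , p , q ← h (here refl) | βs , r , s ← collect I ks G (h ∘ there) =
  αs ++ βs , All.++⁺ p r , λ e →
    trans (cong₂ ℤ._+_ (q e) (s e)) (sym (S-++ αs βs (λ α → N α e)))

-- The sum of antichains A₁ ⊕ A₂ ⊕ ⋯ on the original ground set, so that its linear extensions can
-- be compared with those of P as words.
levelPoset : (Fin n → ℕ) → FinPoset n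
levelPoset b = record
  { _≺_ = λ x y → b x < b y
  ; isDecStrictPartialOrder = record
    { isStrictPartialOrder = record
      { isEquivalence = isEquivalence
      ; irrefl        = λ { refl → ℕ.n≮n _ }
      ; trans         = ℕ.<-trans
      ; <-resp-≈      = (λ { refl p → p }) , (λ { refl p → p })
      }
    ; _≟_  = _≟F_
    ; _<?_ = λ x y → b x ℕ.<? b y
    }
  }

module _ (side : Fin n → Bool) where

  -- Labels on the `false` side lie between 1 and n, those on the `true` side above n.
  twoSided : Labeling n
  twoSided = record { label = label ; positive = positive ; injective = injective }
    where
    label : Fin n → ℕ
    label x = if side x then suc n + toℕ x else suc (toℕ x)
    positive : ∀ x → NonZero (label x)
    positive x with side x
    ... | true  = nonZero
    ... | false = nonZero
    injective : ∀ {x y} → label x ≡ label y → x ≡ y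
    injective {x} {y} e with side x | side y
    ... | true  | true  = toℕ-injective (ℕ.+-cancelˡ-≡ (suc n) _ _ e)
    ... | false | false = toℕ-injective (ℕ.suc-injective e)
    ... | true  | false =
      ⊥-elim (ℕ.<⇒≢ (ℕ.<-≤-trans (toℕ<n y) (ℕ.m≤m+n n (toℕ x))) (sym (ℕ.suc-injective e)))
    ... | false | true  =
      ⊥-elim (ℕ.<⇒≢ (ℕ.<-≤-trans (toℕ<n x) (ℕ.m≤m+n n (toℕ y))) (ℕ.suc-injective e))

  twoSided-< : ∀ {x y} → side x ≡ true → side y ≡ false →
    Labeling.label twoSided y < Labeling.label twoSided x
  twoSided-< {x} {y} p q rewrite p | q = s≤s (ℕ.<-≤-trans (toℕ<n y) (ℕ.m≤m+n n (toℕ x)))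

  shape : List (Fin n) → List ℕ
  shape π = runs (map side π)

  -- The ordered set partition cut out by π, encoded by the index of the block of each element.
  blockOf : List (Fin n) → Fin n → ℕ
  blockOf π = assign _≟F_ 0 π (lev 0 (shape π))

  map-blockOf : ∀ {π} → Unique π → map (blockOf π) π ≡ lev 0 (shape π)
  map-blockOf {π} u = map-assign _≟F_ 0 u
    (sym (trans (length-lev 0 (shape π)) (trans (sum-runs (map side π)) (List.length-map side π))))

  module _ (P : FinPoset n)
           (height-two : ∀ {x y} → FinPoset._≺_ P x y → side x ≡ true × side y ≡ false)
           (covered : ∀ {y} → side y ≡ false → ∃ λ x → FinPoset._≺_ P x y) where
    open FinPoset P

    -- By `covered`, a linear extension begins on the `true` side. Its odd-indexed runs are then
    -- those of the `true` side, which gives both the rank and the parities.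
    shape∈𝒩 : ∀ {π} → π ↭ allFin n → NoInversion P π →
      shape π ∈ 𝒩 n (trues (map side (allFin n))) ×
      map par (lev 0 (shape π)) ≡ map side π
    shape∈𝒩 {π} p ni = ∈-filter⁺ (λ α → rank α ℕ.≟ _)
        (compositions-complete n (runs-composition (map side π)) sum-shape)
        (trans (rank-shape ni all) (↭-length (filter-↭ (Bool._≟ true) (map⁺ side p))))
      , parities ni all
      where
      all : ∀ x → x ∈ π
      all = ↭-allFin-∈ p
      sum-shape : sum (shape π) ≡ n
      sum-shape = trans (sum-runs (map side π)) (trans (List.length-map side π)
        (trans (↭-length p) (List.length-tabulate id)))
      first : ∀ {x ρ} → NoInversion P (x ∷ ρ) → (∀ z → z ∈ x ∷ ρ) → side x ≡ true
      first {x} (h ∷ _) all with side x in eq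
      ... | true  = refl
      ... | false with z , z≺x ← covered eq with all z
      ...   | here refl = ⊥-elim (irrefl refl z≺x)
      ...   | there q   = ⊥-elim (All.lookup h q z≺x)
      rank-shape : ∀ {ρ} → NoInversion P ρ → (∀ z → z ∈ ρ) →
        rank (shape ρ) ≡ trues (map side ρ)
      rank-shape {[]}    ni all = refl
      rank-shape {x ∷ ρ} ni all with side x | first ni all
      ... | true | _ = rank-runs true (map side ρ)
      parities : ∀ {ρ} → NoInversion P ρ → (∀ z → z ∈ ρ) →
        map par (lev 0 (shape ρ)) ≡ map side ρ
      parities {[]}    ni all = refl
      parities {x ∷ ρ} ni all = map-par-lev 0 (side x) (map side ρ) (sym (first ni all))

    module _ {π : List (Fin n)} (perm : π ↭ allFin n) (ni : NoInversion P π) where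
      private
        α = shape π
        b = blockOf π
        Pᵇ = levelPoset b

        b-lev : map b π ≡ lev 0 α
        b-lev = map-blockOf (↭-allFin-unique perm)

        b-par : ∀ x → par (b x) ≡ side x
        b-par x = map-≡-∈ (trans (List.map-∘ π)
          (trans (cong (map par) b-lev) (proj₂ (shape∈𝒩 perm ni)))) (↭-allFin-∈ perm x)

        b-surjective : ∀ x {k} → k ≤ b x → ∃ λ y → b y ≡ k
        b-surjective x k≤ with ∈-map⁻ b (subst (_ ∈_) (sym b-lev)
          (lev-gapless α (runs-composition (map side π))
            (subst (b x ∈_) b-lev (∈-map⁺ b (↭-allFin-∈ perm x))) z≤n k≤))
        ... | y , _ , e = y , sym e

        b-sorted : AllPairs (λ x y → b x ≤ b y) π
        b-sorted = AllPairs.map⁻ (subst (AllPairs _≤_) (sym b-lev) (lev-sorted 0 α))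

        b-mono : ∀ {x y} → x ≺ y → b x < b y
        b-mono {x} {y} r with ∈-AllPairs₂ (AllPairs.zip (b-sorted , ni))
                                (↭-allFin-∈ perm x) (↭-allFin-∈ perm y)
        ... | inj₁ refl           = ⊥-elim (irrefl refl r)
        ... | inj₂ (inj₂ (_ , n)) = ⊥-elim (n r)
        -- Equal blocks would have equal parity, whereas x and y lie on different sides.
        ... | inj₂ (inj₁ (l , _)) = ℕ.≤∧≢⇒< l λ e →
          Bool.not-¬ refl (trans (sym (proj₁ (height-two r))) (trans (sym (b-par x))
            (trans (cong par e) (trans (b-par y) (proj₂ (height-two r))))))

        same-block⁻ : ∀ {ρ} → ρ ↭ allFin n → (∀ x → blockOf ρ x ≡ b x) → NoInversion Pᵇ ρ
        same-block⁻ {ρ} q e = AllPairs.map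
          (λ {x} {y} l l′ → ℕ.n≮n _ (ℕ.<-≤-trans l′ (subst₂ _≤_ (e x) (e y) l)))
          (AllPairs.map⁻ (subst (AllPairs _≤_) (sym (map-blockOf (↭-allFin-unique q)))
            (lev-sorted 0 (shape ρ))))

        -- Being sorted, the levels along ρ are those along π. Their parities are the sides, so ρ
        -- and π have the same shape and cut out the same blocks.
        same-block⁺ : ∀ {ρ} → ρ ↭ allFin n → NoInversion Pᵇ ρ → ∀ x → blockOf ρ x ≡ b x
        same-block⁺ {ρ} q ni′ x = map-≡-∈
          (trans (map-blockOf (↭-allFin-unique q)) (trans (cong (lev 0) shape≡) (sym ρ-lev)))
          (↭-allFin-∈ q x)
          where
          ρ-lev : map b ρ ≡ lev 0 α
          ρ-lev = sorted-unique ℕ.≤-antisym (AllPairs.map⁺ (AllPairs.map ℕ.≮⇒≥ ni′))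
            (lev-sorted 0 α)
            (↭-trans (map⁺ b (↭-trans q (↭-sym perm))) (↭-reflexive b-lev))
          shape≡ : shape ρ ≡ α
          shape≡ = cong runs (begin
            map side ρ         ≡⟨ List.map-cong b-par ρ ⟨
            map (par ∘ b) ρ    ≡⟨ List.map-∘ ρ ⟩
            map par (map b ρ)  ≡⟨ cong (map par) (trans ρ-lev (sym b-lev)) ⟩
            map par (map b π)  ≡⟨ List.map-∘ π ⟨
            map (par ∘ b) π    ≡⟨ List.map-cong b-par π ⟩
            map side π         ∎)
            where open ≡-Reasoning

        match = matching {f = b} {block 0 α} perm ↭-refl (trans b-lev (sym (map-block α)))
        to      = proj₁ match
        from    = proj₁ (proj₂ match)
        from-to = proj₁ (proj₂ (proj₂ match))
        to-from = proj₁ (proj₂ (proj₂ (proj₂ match)))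
        b≡block = proj₂ (proj₂ (proj₂ (proj₂ match)))

        iso : Pᵇ ≅ chainOfAntichains α
        iso = record
          { to = to ; from = from ; from-to = from-to ; to-from = to-from
          ; to-≺ = λ {x} {y} r → block-<⇒≺ 0 α (subst₂ _<_ (b≡block x) (b≡block y) r)
          ; from-≺ = λ {x} {y} r → subst₂ _<_
              (sym (trans (b≡block (from x)) (cong (block 0 α) (to-from x))))
              (sym (trans (b≡block (from y)) (cong (block 0 α) (to-from y))))
              (≺⇒block-< 0 α r)
          }

        label₁ = Labeling.label twoSided
        label₂ = Labeling.label (labeling α) ∘ to

        -- Across one block boundary both labelings descend from an
        -- odd-numbered block to the next and ascend from an even-numbered one.
        agree : ∀ {x y} → b y ≡ suc (b x) → AgreeAt Pᵇ label₁ label₂ x y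
        agree {x} {y} e = ℕ.≤-reflexive (sym e) , by-parity (par (b x)) refl
          where
          parity-y : par (b y) ≡ not (par (b x))
          parity-y = cong par e
          by-parity : ∀ p → par (b x) ≡ p → label₁ x < label₁ y ⇔ label₂ x < label₂ y
          by-parity true p = mk⇔
            (λ l → ⊥-elim (ℕ.<-asym l (twoSided-< (trans (sym (b-par x)) p)
              (trans (sym (b-par y)) (trans parity-y (cong not p))))))
            (λ l → ⊥-elim (ℕ.<-asym l (labeling-< α (trans (cong par (sym (b≡block x))) p)
              (trans (cong par (sym (b≡block y))) (trans parity-y (cong not p))))))
          by-parity false p = mk⇔
            (λ _ → labeling-< α (trans (cong par (sym (b≡block y))) (trans parity-y (cong not p)))
              (trans (cong par (sym (b≡block x))) p))
            (λ _ → twoSided-< (trans (sym (b-par y)) (trans parity-y (cong not p)))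
              (trans (sym (b-par x)) p))

        -- Blocks of equal parity may be labeled in different orders, so the chain passes through an
        -- element of each of the d blocks strictly between x and y.
        chain : ∀ d {x y} → b y ≡ d + suc (b x) → TransClosure (AgreeAt Pᵇ label₁ label₂) x y
        chain zero    e = [ agree e ]
        chain (suc d) {x} {y} e
          with z , q ← b-surjective y {suc (b x)} (subst (suc (b x) ≤_) (sym e) (ℕ.m≤n+m _ (suc d))) =
          agree q ∷ chain d (trans e (trans (sym (ℕ.+-suc d _)) (cong (λ k → d + suc k) (sym q))))

      F-levelPoset : F Pᵇ twoSided ≈ N α
      F-levelPoset = F-cong iso twoSided (labeling α) λ {x} {y} r →
        chain (b y ℕ.∸ suc (b x)) (sym (ℕ.m∸n+n≡m r))

      -- The predicate R selects the words with the ordered partition of π. Such words are sorted by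
      -- `b`; conversely, `b-mono` makes every word sorted by `b` a linear extension of P.
      linearExtensions-levelPoset : ∀ {R : List (Fin n) → Set} (R? : Decidable R) →
        (∀ {ρ} → (∀ x → blockOf ρ x ≡ b x) → R ρ) → (∀ {ρ} → R ρ → ∀ x → blockOf ρ x ≡ b x) →
        filter R? (linearExtensions P) ↭ linearExtensions Pᵇ
      linearExtensions-levelPoset R? R⁺ R⁻ = ∼bag⇒↭ (unique∧set⇒bag
        (Unique.filter⁺ R? (linearExtensions-unique P)) (linearExtensions-unique Pᵇ)
        (mk⇔ forth back))
        where
        forth : ∀ {ρ} → ρ ∈ filter R? (linearExtensions P) → ρ ∈ linearExtensions Pᵇ
        forth p with le , r ← ∈-filter⁻ R? {xs = linearExtensions P} p
                with q , _ ← ∈-linearExtensions⁻ P le =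
          ∈-linearExtensions⁺ Pᵇ q (same-block⁻ q (R⁻ r))
        back : ∀ {ρ} → ρ ∈ linearExtensions Pᵇ → ρ ∈ filter R? (linearExtensions P)
        back p with q , ni′ ← ∈-linearExtensions⁻ Pᵇ p = ∈-filter⁺ R?
          (∈-linearExtensions⁺ P q (AllPairs.map (λ n r → n (b-mono r)) ni′))
          (R⁺ (same-block⁺ q ni′))

    expansion-twoSided : ∃ λ αs →
      All (_∈ 𝒩 n (trues (map side (allFin n)))) αs × F P twoSided ≈ ∑ αs N
    expansion-twoSided = αs , proj₁ (proj₂ collected) , λ e → trans
      (S-group _≟ᴸ_ key (λ π → summand π e) keys (deduplicate-! _≟ᴸ_ (map key (linearExtensions P)))
        (linearExtensions P) (All.tabulate λ p → ∈-deduplicate⁺ _≟ᴸ_ (∈-map⁺ key p)))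
      (proj₂ (proj₂ collected) e)
      where
      _≟ᴸ_ = List.≡-dec ℕ._≟_
      -- Tabulating the block function gives ordered partitions a decidable equality to group by.
      key : List (Fin n) → List ℕ
      key π = map (blockOf π) (allFin n)
      keys = deduplicate _≟ᴸ_ (map key (linearExtensions P))
      summand : List (Fin n) → Series
      summand π = L (C (map (Labeling.label twoSided) π))
      fibre : List ℕ → Series
      fibre k = ∑ (filter (λ π → key π ≟ᴸ k) (linearExtensions P)) summand
      part : ∀ {k} → k ∈ keys → ∃ λ αs →
        All (_∈ 𝒩 n (trues (map side (allFin n)))) αs × fibre k ≈ ∑ αs N
      part p with π , π∈ , refl ← ∈-map⁻ key (∈-deduplicate⁻ _≟ᴸ_ (map key (linearExtensions P)) p)
             with perm , ni ← ∈-linearExtensions⁻ P π∈ =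
        shape π ∷ [] , proj₁ (shape∈𝒩 perm ni) ∷ [] , λ e → trans
          (S-↭ (λ ρ → summand ρ e) (linearExtensions-levelPoset perm ni (λ ρ → key ρ ≟ᴸ key π)
            (λ h → List.map-cong h (allFin n)) (λ h x → map-≡-∈ h (∈-allFin x))))
          (trans (F-levelPoset perm ni e) (sym (ℤ.+-identityʳ _)))
      collected = collect (_∈ 𝒩 n (trues (map side (allFin n)))) keys fibre part
      αs = proj₁ collected

    -- Every relation leads from the `true` side to the `false` side, where a strict labeling and
    -- `twoSided` both descend.
    expansion : ∀ (ω : Labeling n) → IsStrict P ω → ∃ λ αs →
      All (_∈ 𝒩 n (trues (map side (allFin n)))) αs × F P ω ≈ ∑ αs N
    expansion ω strict with αs , p , q ← expansion-twoSided =
      αs , p , λ e → trans (F-cong {P = P} {P} (≅-refl {P = P}) ω twoSided compat e) (q e)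
      where
      compat : Compatible P P (≅-refl {P = P}) ω twoSided
      compat r = let p , q = height-two r in
        [ r , mk⇔ (λ l → ⊥-elim (ℕ.<-asym l (strict r)))
                  (λ l → ⊥-elim (ℕ.<-asym l (twoSided-< p q))) ]

-- Matroids

∈-─⁻ : ∀ (p q : Subset n) {x} → x ∈ₛ p ─ q → x ∉ₛ q
∈-─⁻ (_ ∷ p) (inside ∷ q)  (Vec.there h) (Vec.there h′) = ∈-─⁻ p q h h′
∈-─⁻ (_ ∷ p) (outside ∷ q) (Vec.there h) (Vec.there h′) = ∈-─⁻ p q h h′

∈-exchange⁻ : ∀ {e e′ : Fin n} (B : Subset n) {x} → x ∈ₛ exchange e e′ B →
  (x ∈ₛ B × x ≢ e) ⊎ x ≡ e′
∈-exchange⁻ {e = e} {e′} B h with Subset.x∈p∪q⁻ (B - e) ⁅ e′ ⁆ h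
... | inj₁ p = inj₁ (Subset.p─q⊆p B ⁅ e ⁆ p , λ { refl → ∈-─⁻ B ⁅ e ⁆ p (Subset.x∈⁅x⁆ e) })
... | inj₂ p = inj₂ (Subset.x∈⁅y⁆⇒x≡y e′ p)

∈-exchange⁺ : ∀ {e e′ : Fin n} (B : Subset n) {x} → x ∈ₛ B → x ≢ e → x ∈ₛ exchange e e′ B
∈-exchange⁺ B p ne = Subset.x∈p∪q⁺ (inj₁ (Subset.x∈p∧x≢y⇒x∈p-y p ne))

∈-exchange-new : ∀ e e′ (B : Subset n) → e′ ∈ₛ exchange e e′ B
∈-exchange-new e e′ B = Subset.x∈p∪q⁺ {p = B - e} (inj₂ (Subset.x∈⁅x⁆ e′))

∣p-x∣ : ∀ {x} {p : Subset n} → x ∈ₛ p → suc ∣ p - x ∣ ≡ ∣ p ∣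
∣p-x∣ {p = inside ∷ p}  Vec.here      = cong (suc ∘ ∣_∣) (Subset.p─⊥≡p p)
∣p-x∣ {p = inside ∷ p}  (Vec.there h) = cong suc (∣p-x∣ h)
∣p-x∣ {p = outside ∷ p} (Vec.there h) = ∣p-x∣ h

∣p∪⁅x⁆∣ : ∀ x (p : Subset n) → x ∉ₛ p → ∣ p ∪ ⁅ x ⁆ ∣ ≡ suc ∣ p ∣
∣p∪⁅x⁆∣ Fin.zero    (inside ∷ p)  h = ⊥-elim (h Vec.here)
∣p∪⁅x⁆∣ Fin.zero    (outside ∷ p) h = cong (suc ∘ ∣_∣) (Subset.∪-identityʳ p)
∣p∪⁅x⁆∣ (Fin.suc x) (inside ∷ p)  h = cong suc (∣p∪⁅x⁆∣ x p (h ∘ Vec.there))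
∣p∪⁅x⁆∣ (Fin.suc x) (outside ∷ p) h = ∣p∪⁅x⁆∣ x p (h ∘ Vec.there)

∣exchange∣ : ∀ {e e′} (B : Subset n) → e ∈ₛ B → e′ ∉ₛ B → ∣ exchange e e′ B ∣ ≡ ∣ B ∣
∣exchange∣ {e = e} {e′} B p q =
  trans (∣p∪⁅x⁆∣ e′ (B - e) (q ∘ Subset.p─q⊆p B ⁅ e ⁆)) (∣p-x∣ p)

-- The measure for the recursions on exchanges: e leaves the difference, and e′, lying in B′, does
-- not enter it.
exchange-closer : ∀ {e e′} (B B′ : Subset n) → e ∈ₛ B → e ∉ₛ B′ → e′ ∈ₛ B′ →
  ∣ exchange e e′ B ─ B′ ∣ < ∣ B ─ B′ ∣
exchange-closer {e = e} {e′} B B′ e∈ e∉ e′∈ = Subset.p⊂q⇒∣p∣<∣q∣ (sub , e , Subset.x∈p∧x∉q⇒x∈p─q e∈ e∉ , e∉E)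
  where
  E = exchange e e′ B
  sub : E ─ B′ ⊆ B ─ B′
  sub {x} p with ∈-exchange⁻ B (Subset.p─q⊆p E B′ p)
  ... | inj₁ (q , _) = Subset.x∈p∧x∉q⇒x∈p─q q (∈-─⁻ E B′ p)
  ... | inj₂ refl    = ⊥-elim (∈-─⁻ E B′ p e′∈)
  e∉E : e ∉ₛ E ─ B′
  e∉E p with ∈-exchange⁻ B (Subset.p─q⊆p E B′ p)
  ... | inj₁ (_ , ne) = ne refl
  ... | inj₂ refl     = e∉ e′∈

trues-lookup : ∀ {n} (B : Subset n) → trues (map (lookup B) (allFin n)) ≡ ∣ B ∣
trues-lookup B = trans (cong trues (List.map-tabulate id (lookup B))) (go B)
  where
  go : ∀ {n} (B : Subset n) → trues (tabulate (lookup B)) ≡ ∣ B ∣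
  go []            = refl
  go (inside ∷ B)  = cong suc (go B)
  go (outside ∷ B) = go B

module _ (M : Matroid n) where
  open Matroid M

  -- An element of B′ outside B would have to be exchanged for one of B outside B′, and there is
  -- none.
  basis-⊆⇒≡ : ∀ {B B′} → IsBasis B → IsBasis B′ → B ⊆ B′ → B ≡ B′
  basis-⊆⇒≡ {B} {B′} b b′ sub = Subset.⊆-antisym sub sup
    where
    sup : B′ ⊆ B
    sup {e} e∈ with e Subset.∈? B
    ... | yes p = p
    ... | no e∉ with e′ , e′∈ , e′∉ , _ ← basisExchange b′ b e∈ e∉ = ⊥-elim (e′∉ (sub e′∈))

  private
    outlier? : ∀ (B B′ : Subset n) → Dec (∃ λ e → e ∈ₛ B × e ∉ₛ B′)
    outlier? B B′ = any? λ e → (e Subset.∈? B) ×-dec ¬? (e Subset.∈? B′)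

    no-outlier : ∀ {B B′ : Subset n} → ¬ (∃ λ e → e ∈ₛ B × e ∉ₛ B′) → B ⊆ B′
    no-outlier {B} {B′} h {e} p with e Subset.∈? B′
    ... | yes q = q
    ... | no q  = ⊥-elim (h (e , p , q))

  -- Exchanges preserve cardinality and move B towards B′ until it is contained in B′. The number k
  -- bounds the elements still to be exchanged.
  equicardinal : ∀ {B B′} → IsBasis B → IsBasis B′ → ∣ B ∣ ≡ ∣ B′ ∣
  equicardinal {B} {B′} b b′ = go (suc ∣ B ─ B′ ∣) b ℕ.≤-refl
    where
    go : ∀ k {B} → IsBasis B → ∣ B ─ B′ ∣ < k → ∣ B ∣ ≡ ∣ B′ ∣
    go (suc k) {B} b (s≤s l) with outlier? B B′
    ... | no h = cong ∣_∣ (basis-⊆⇒≡ b b′ (no-outlier h))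
    ... | yes (e , e∈ , e∉) with e′ , e′∈ , e′∉ , b₁ ← basisExchange b b′ e∈ e∉ =
      trans (sym (∣exchange∣ B e∈ e′∉))
            (go k b₁ (ℕ.<-≤-trans (exchange-closer B B′ e∈ e∉ e′∈) l))

  -- Exchanging the elements of B₀ other than y into B ends at B − g + y.
  basis-through : ∀ {B B₀ y} → IsBasis B → y ∉ₛ B → IsBasis B₀ → y ∈ₛ B₀ →
    ∃ λ g → g ∈ₛ B × y ∉ₛ B × IsBasis (exchange g y B)
  basis-through {B} {B₀} {y} b y∉ b₀ y∈ = go (suc ∣ B₀ ─ B ∣) b₀ y∈ ℕ.≤-refl
    where
    go : ∀ k {B₀} → IsBasis B₀ → y ∈ₛ B₀ → ∣ B₀ ─ B ∣ < k →
         ∃ λ g → g ∈ₛ B × y ∉ₛ B × IsBasis (exchange g y B)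
    go (suc k) {B₀} b₀ y∈ (s≤s l)
      with any? (λ f → ((f Subset.∈? B₀) ×-dec ¬? (f Subset.∈? B)) ×-dec ¬? (f ≟F y))
    ... | yes (f , (f∈ , f∉) , f≢y) with g , g∈ , _ , b₁ ← basisExchange b₀ b f∈ f∉ =
      go k b₁ (∈-exchange⁺ B₀ y∈ (f≢y ∘ sym)) (ℕ.<-≤-trans (exchange-closer B₀ B f∈ f∉ g∈) l)
    -- Now y is the only element of B₀ outside B. Exchanging it for g gives a basis inside B, hence
    -- B itself, and undoing the exchange shows that B₀ is B - g + y.
    ... | no h with g , g∈ , g∉ , b₁ ← basisExchange b₀ b y∈ y∉ =
      g , g∈ , y∉ , subst IsBasis (Subset.⊆-antisym ⊆₁ ⊆₂) b₀
      where
      B₁ = exchange y g B₀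
      B₁⊆B : B₁ ⊆ B
      B₁⊆B {x} p with ∈-exchange⁻ B₀ p
      ... | inj₂ refl     = g∈
      ... | inj₁ (q , ne) = decidable-stable (x Subset.∈? B) λ x∉ → h (x , (q , x∉) , ne)
      B₁≡B : B₁ ≡ B
      B₁≡B = basis-⊆⇒≡ b₁ b B₁⊆B
      ⊆₁ : B₀ ⊆ exchange g y B
      ⊆₁ {x} p with x ≟F y
      ... | yes refl = ∈-exchange-new g y B
      ... | no ne    = ∈-exchange⁺ B (B₁⊆B (∈-exchange⁺ B₀ p ne)) λ { refl → g∉ p }
      ⊆₂ : exchange g y B ⊆ B₀
      ⊆₂ {x} p with ∈-exchange⁻ B p
      ... | inj₂ refl     = y∈
      ... | inj₁ (q , ne) with ∈-exchange⁻ B₀ (subst (x ∈ₛ_) (sym B₁≡B) q)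
      ...   | inj₁ (r , _) = r
      ...   | inj₂ e       = ⊥-elim (ne e)

  module _ (loopless : Loopless M) {B : Subset n} (b : IsBasis B) where

    height-two : ∀ {x y} → FinPoset._≺_ (basisPoset M B) x y →
      lookup B x ≡ true × lookup B y ≡ false
    height-two {x} {y} (p , q , _) =
      []=⇒lookup p , Bool.¬-not λ e → q (lookup⇒[]= y B e)

    -- As a negation, `Loopless` yields a basis through y only under a double negation; the finite
    -- search for x removes it.
    covered : ∀ {y} → lookup B y ≡ false → ∃ λ x → FinPoset._≺_ (basisPoset M B) x y
    covered {y} e = decidable-stable (any? λ x → FinPoset._≺?_ (basisPoset M B) x y)
      λ h → loopless y λ b₀ y∈ → h (basis-through b y∉ b₀ y∈)
      where
      y∉ : y ∉ₛ B
      y∉ p with () ← trans (sym e) ([]=⇒lookup p)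

theorem5p2 : ∀ {n r : ℕ} (M : Matroid n) → Loopless M → HasRank M r →
    (ω : LabelingChoice M) → IsStrictChoice M ω →
    V n r (Fᴹ M ω) ×
    (∃ λ (c : List ℕ → ℕ) → Fᴹ M ω ≈ combination n r (λ α → + c α))
theorem5p2 {n} {r} M loopless (B₀ , b₀ , ∣B₀∣) ω strict =
  ((λ α → + c α) , expand) , c , expand
  where
  part : ∀ {B} → B ∈ bases M →
    ∃ λ αs → All (_∈ 𝒩 n r) αs × F (basisPoset M B) (ω B) ≈ ∑ αs N
  part {B} p with _ , b ← ∈-filter⁻ (Matroid.isBasis? M) {xs = subsets n} p =
    -- The rank found by `expansion` is the size of B, which is r for every basis.
    subst (λ k → ∃ λ αs → All (_∈ 𝒩 n k) αs × F (basisPoset M B) (ω B) ≈ ∑ αs N)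
      (trans (trues-lookup B) (trans (equicardinal M b b₀) ∣B₀∣))
      (expansion (lookup B) (basisPoset M B) (height-two M loopless b) (covered M loopless b)
        (ω B) (strict b))
  collected = collect (_∈ 𝒩 n r) (bases M) (λ B → F (basisPoset M B) (ω B)) part
  αs = proj₁ collected
  c : List ℕ → ℕ
  -- One list of indices serves all bases, and the coefficient of N_α is the number of times α
  -- occurs in it.
  c = multiplicity (List.≡-dec ℕ._≟_) αs
  expand : Fᴹ M ω ≈ combination n r (λ α → + c α)
  expand e = trans (proj₂ (proj₂ collected) e)
    (S-multiplicity (List.≡-dec ℕ._≟_) (λ α → N α e)
      (Unique.filter⁺ (λ α → rank α ℕ.≟ r) (compositions-unique n)) αs (proj₁ (proj₂ collected)))
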